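{- Given a $(c,\ell,k)$-tree-cover of a graph $G$ with $n$ vertices, greedy routing on $G$ can be implemented such that the routing scheme is starvation-free, has stretch $c$ with additive bound $\ell$, stores $\mathcal{O}(k(\log^2 n+\log k))$ bits at each vertex, and takes $\mathcal{O}(k)$ time for a routing decision.
   Context: Graphs are finite, simple and undirected. For a graph $H$, $d_H(s,t)$ is the length (number of edges) of a shortest $s$-$t$-path in $H$ (treated as $\infty$ if $s$ or $t$ is not in $H$ or no path exists). A $(c,\ell,k)$-tree-cover $\mathcal{C}$ of $G=(V,E)$, with $c\ge1$ and $\ell\ge 0$, is a collection of subgraphs of $G$, each of which is a tree, such that (i) for all $s,t\in V$ there is a tree $G'\in\mathcal{C}$ containing $s,t$ with $d_{G'}(s,t)\le c\cdot d_G(s,t)$ or $d_{G'}(s,t)\le d_G(s,t)+\ell$, and (ii) every vertex is contained in at most $k$ trees of $\mathcal{C}$. Greedy routing with respect to a semi-metric $d$ on $V$: a message with target $t$ at a vertex $s\ne t$ is forwarded to a neighbor $v$ of $s$ in $G$ with $d(v,t)<d(s,t)$. In an implementation, each vertex $s$ stores a label and has assigned its neighbors unique ports from $\{1,\dots,n\}$; a routing decision at $s$ for target $t$ consists of determining, from the labels of $s$ and $t$ only, the port of the neighbor to which the message is forwarded. The scheme is starvation-free if delivery is guaranteed, i.e. at every $s\ne t$ there is a neighbor to which the message can be forwarded and it eventually reaches $t$. It has stretch $c$ with additive bound $\ell$ if for all $s\ne t$ the routed path from $s$ to $t$ has length at most $c\cdot d_G(s,t)$ or at most $d_G(s,t)+\ell$.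 -}

module Defs where

open import Data.Bool using (Bool; if_then_else_; _∧_; _∨_; _xor_)
open import Data.Fin using (Fin; toℕ)
open import Data.Fin.Subset using (Subset; Nonempty) renaming (_∈_ to _∈ₛ_)
open import Data.Fin.Subset.Properties using () renaming (_∈?_ to _∈ₛ?_)
open import Data.Integer using (+_)
open import Data.List using (List; []; _∷_; head; drop; length; filter)
open import Data.List.Relation.Unary.All using (All)
open import Data.List.Relation.Unary.Any using (Any)
open import Data.List.Relation.Unary.Unique.Propositional using (Unique)
open import Data.Maybe using (Maybe; just; nothing; maybe)
open import Data.Nat using (ℕ; zero; suc; _+_; _*_; _∸_; _^_; _≤_; _<ᵇ_; _≡ᵇ_; _/_; _%_)
open import Data.Nat.Logarithm using (⌊log₂_⌋)
open import Data.Nat.Properties using (m^n≢0)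
open import Data.Product using (∃-syntax; _×_; _,_)
open import Data.Rational as ℚ using (ℚ; 0ℚ; 1ℚ)
import Data.Rational.Properties as ℚ
open import Data.Sum using (_⊎_; inj₁; inj₂)
open import Function.Bundles using (_⇔_; mk⇔)
open import Level using (0ℓ)
open import Relation.Binary using (Rel; Decidable; Symmetric; Irreflexive; tri<; tri≈; tri>)
open import Relation.Binary.Construct.Closure.ReflexiveTransitive using (Star; ε; _◅_)
open import Relation.Binary.PropositionalEquality using (_≡_; _≢_; refl; subst)
open import Relation.Nullary using (¬_)

------------------------------------------------------------------------
-- Real numbers (Dedekind cuts)

record ℝ : Set₁ where
  field
    L U       : ℚ → Set
    inhabited : (∃[ q ] L q) × (∃[ q ] U q)
    L-rounded : ∀ q → L q ⇔ (∃[ r ] q ℚ.< r × L r)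
    U-rounded : ∀ q → U q ⇔ (∃[ r ] r ℚ.< q × U r)
    disjoint  : ∀ q → ¬ (L q × U q)
    located   : ∀ {q r} → q ℚ.< r → L q ⊎ U r

open ℝ public

infix 4 _≤ᵣ_ _<ᵣ_ _≃ᵣ_

_≤ᵣ_ _<ᵣ_ _≃ᵣ_ : ℝ → ℝ → Set
x ≤ᵣ y = ∀ {q} → L x q → L y q
x <ᵣ y = ∃[ q ] U x q × L y q
x ≃ᵣ y = (x ≤ᵣ y) × (y ≤ᵣ x)

private
  q<q+1 : ∀ q → q ℚ.< q ℚ.+ 1ℚ
  q<q+1 q = subst (ℚ._< q ℚ.+ 1ℚ) (ℚ.+-identityʳ q) (ℚ.+-monoʳ-< q (ℚ.positive⁻¹ 1ℚ))

  q-1<q : ∀ q → q ℚ.- 1ℚ ℚ.< q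
  q-1<q q = subst (q ℚ.- 1ℚ ℚ.<_) (ℚ.+-identityʳ q) (ℚ.+-monoʳ-< q (ℚ.negative⁻¹ (ℚ.- 1ℚ)))

fromℚ : ℚ → ℝ
fromℚ p .L q         = q ℚ.< p
fromℚ p .U q         = p ℚ.< q
fromℚ p .inhabited   = (p ℚ.- 1ℚ , q-1<q p) , (p ℚ.+ 1ℚ , q<q+1 p)
fromℚ p .L-rounded q = mk⇔ ℚ.<-dense (λ (_ , q<r , r<p) → ℚ.<-trans q<r r<p)
fromℚ p .U-rounded q =
  mk⇔ (λ p<q → let r , p<r , r<q = ℚ.<-dense p<q in r , r<q , p<r)
      (λ (_ , r<q , p<r) → ℚ.<-trans p<r r<q)
fromℚ p .disjoint q (q<p , p<q) = ℚ.<-asym q<p p<q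
fromℚ p .located {q} {r} q<r with ℚ.<-cmp q p
... | tri< q<p _ _  = inj₁ q<p
... | tri≈ _ refl _ = inj₂ q<r
... | tri> _ _ p<q  = inj₂ (ℚ.<-trans p<q q<r)

0ᵣ 1ᵣ : ℝ
0ᵣ = fromℚ 0ℚ
1ᵣ = fromℚ 1ℚ

fromℕ : ℕ → ℚ
fromℕ m = + m ℚ./ 1

-- A real is the infimum of its upper cut, so for m ≥ 0 the inequalities
-- a ≤ x · m and a ≤ m + x may be tested on the rationals above x.
_≤_·_ : ℕ → ℝ → ℕ → Set
a ≤ x · m = ∀ {q} → U x q → fromℕ a ℚ.≤ q ℚ.* fromℕ m

_≤_⊕_ : ℕ → ℕ → ℝ → Set
a ≤ m ⊕ x = ∀ {q} → U x q → fromℕ a ℚ.≤ fromℕ m ℚ.+ q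

WithinStretch : (c ℓ : ℝ) (a m : ℕ) → Set
WithinStretch c ℓ a m = (a ≤ c · m) ⊎ (a ≤ m ⊕ ℓ)

------------------------------------------------------------------------
-- Graphs, paths and distances

record Graph (n : ℕ) : Set₁ where
  field
    _~_      : Rel (Fin n) 0ℓ
    _~?_     : Decidable _~_
    ~-sym    : Symmetric _~_
    ~-irrefl : Irreflexive _≡_ _~_

module _ {n : ℕ} {E : Rel (Fin n) 0ℓ} where

  vertices : ∀ {s t} → Star E s t → List (Fin n)
  vertices {s} ε       = s ∷ []
  vertices {s} (_ ◅ p) = s ∷ vertices p

  edges : ∀ {s t} → Star E s t → ℕ
  edges ε       = 0
  edges (_ ◅ p) = suc (edges p)

record Path {n : ℕ} (E : Rel (Fin n) 0ℓ) (s t : Fin n) : Set where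
  constructor path
  field
    walk   : Star E s t
    simple : Unique (vertices walk)

  len : ℕ
  len = edges walk

open Path public using (len)

-- Distance E s t m: the distance of s and t in the graph with edge relation E
-- is the natural number m.  It holds for no m if there is no s-t-path.
record Distance {n : ℕ} (E : Rel (Fin n) 0ℓ) (s t : Fin n) (m : ℕ) : Set where
  field
    attained : ∃[ p ] len {E = E} {s} {t} p ≡ m
    shortest : ∀ (p : Path E s t) → m ≤ len p

record Subgraph {n : ℕ} (G : Graph n) : Set₁ where
  open Graph G using (_~_)
  field
    V        : Subset n
    Edge     : Rel (Fin n) 0ℓ
    Edge?    : Decidable Edge
    Edge-sym : Symmetric Edge
    Edge⊆V   : ∀ {u v} → Edge u v → u ∈ₛ V
    Edge⊆G   : ∀ {u v} → Edge u v → u ~ v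

record IsTree {n : ℕ} {G : Graph n} (H : Subgraph G) : Set where
  open Subgraph H
  field
    nonempty  : Nonempty V
    connected : ∀ {u v} → u ∈ₛ V → v ∈ₛ V → Path Edge u v
    -- a cycle is a path with at least two edges together with an edge
    -- joining its ends
    acyclic   : ∀ {u v} (p : Path Edge u v) → 2 ≤ len p → ¬ Edge v u

record IsTreeCover {n : ℕ} (G : Graph n) (c ℓ : ℝ) (k : ℕ) (𝒞 : List (Subgraph G)) : Set₁ where
  open Graph G using (_~_)
  open Subgraph
  field
    c≥1    : 1ᵣ ≤ᵣ c
    ℓ≥0    : 0ᵣ ≤ᵣ ℓ
    trees  : All IsTree 𝒞
    covers : ∀ s t → Any (λ H → s ∈ₛ V H × t ∈ₛ V H ×
               ∃[ a ] ∃[ m ] Distance (Edge H) s t a × Distance _~_ s t m ×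
                             WithinStretch c ℓ a m) 𝒞
    sparse : ∀ v → length (filter (λ H → v ∈ₛ? V H) 𝒞) ≤ k

record IsSemiMetric {n : ℕ} (d : Fin n → Fin n → ℝ) : Set where
  field
    nonNegative : ∀ s t → 0ᵣ ≤ᵣ d s t
    definite    : ∀ s t → (d s t ≃ᵣ 0ᵣ) ⇔ (s ≡ t)
    symmetric   : ∀ s t → d s t ≃ᵣ d t s

------------------------------------------------------------------------
-- Word RAM with w-bit words

data Op : Set where
  add sub mul div mod and or xor shl shr : Op

data Segment : Set where
  source target scratch : Segment

-- The natural numbers that are not constants are names of registers or,
-- in jumps, addresses in the program.
data Instr : Set where
  const : (r m : ℕ) → Instr                 -- r ← m
  arith : (o : Op) (r a b : ℕ) → Instr      -- r ← a ⟨o⟩ b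
  load  : (g : Segment) (r a : ℕ) → Instr   -- r ← g[a]
  store : (a b : ℕ) → Instr                 -- scratch[a] ← b
  jump< : (a b l : ℕ) → Instr               -- if a < b then go to l
  halt  : (r : ℕ) → Instr                   -- return r

Program : Set
Program = List Instr

Word : ℕ → Set
Word w = Fin (2 ^ w)

Label : ℕ → Set
Label w = List (Word w)

read : ∀ w → Label w → ℕ → ℕ
read w x i = maybe toℕ 0 (head (drop i x))

bitwise : (Bool → Bool → Bool) → (w : ℕ) → ℕ → ℕ → ℕ
bitwise f zero    a b = 0
bitwise f (suc w) a b =
  (if f (a % 2 ≡ᵇ 1) (b % 2 ≡ᵇ 1) then 1 else 0) + 2 * bitwise f w (a / 2) (b / 2)

trunc : ℕ → ℕ → ℕ
trunc w a = (a % (2 ^ w)) {{m^n≢0 2 w}}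

-- Operands are words, i.e. less than 2 ^ w.
⟦_⟧ : Op → (w : ℕ) → ℕ → ℕ → ℕ
⟦ add ⟧ w a b       = trunc w (a + b)
⟦ sub ⟧ w a b       = trunc w (a + (2 ^ w ∸ b))
⟦ mul ⟧ w a b       = trunc w (a * b)
⟦ div ⟧ w a zero    = 0
⟦ div ⟧ w a (suc b) = a / suc b
⟦ mod ⟧ w a zero    = 0
⟦ mod ⟧ w a (suc b) = a % suc b
⟦ and ⟧ w a b       = bitwise _∧_ w a b
⟦ or  ⟧ w a b       = bitwise _∨_ w a b
⟦ xor ⟧ w a b       = bitwise _xor_ w a b
⟦ shl ⟧ w a b       = trunc w (a * 2 ^ b)
⟦ shr ⟧ w a b       = (a / (2 ^ b)) {{m^n≢0 2 b}}

record State : Set where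
  constructor state
  field
    pc      : ℕ
    reg mem : ℕ → ℕ

_[_≔_] : (ℕ → ℕ) → ℕ → ℕ → (ℕ → ℕ)
(f [ i ≔ x ]) j = if j ≡ᵇ i then x else f j

module _ (w : ℕ) (P : Program) (x y : Label w) where

  fetch : Segment → (ℕ → ℕ) → ℕ → ℕ
  fetch source  mem i = read w x i
  fetch target  mem i = read w y i
  fetch scratch mem i = mem i

  -- The result if the program halts within the given number of steps.
  runFrom : ℕ → State → Maybe ℕ
  exec    : ℕ → Maybe Instr → State → Maybe ℕ

  runFrom zero    σ = nothing
  runFrom (suc f) σ = exec f (head (drop (State.pc σ) P)) σ

  exec f nothing                σ                = nothing
  exec f (just (const r m))     (state pc reg mem) =
    runFrom f (state (suc pc) (reg [ r ≔ trunc w m ]) mem)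
  exec f (just (arith o r a b)) (state pc reg mem) =
    runFrom f (state (suc pc) (reg [ r ≔ ⟦ o ⟧ w (reg a) (reg b) ]) mem)
  exec f (just (load g r a))    (state pc reg mem) =
    runFrom f (state (suc pc) (reg [ r ≔ fetch g mem (reg a) ]) mem)
  exec f (just (store a b))     (state pc reg mem) =
    runFrom f (state (suc pc) reg (mem [ reg a ≔ reg b ]))
  exec f (just (jump< a b l))   (state pc reg mem) =
    runFrom f (state (if reg a <ᵇ reg b then l else suc pc) reg mem)
  exec f (just (halt r))        (state pc reg mem) = just (reg r)

  run : ℕ → Maybe ℕ
  run f = runFrom f (state 0 (λ _ → 0) (λ _ → 0))

------------------------------------------------------------------------
-- Routing schemes

record Scheme {n : ℕ} (G : Graph n) (w : ℕ) : Set where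
  open Graph G using (_~_)
  field
    label       : Fin n → Label w
    port        : Fin n → Fin n → ℕ
    port-range  : ∀ {s v} → s ~ v → 1 ≤ port s v × port s v ≤ n
    port-unique : ∀ {s u v} → s ~ u → s ~ v → port s u ≡ port s v → u ≡ v

  storedBits : Fin n → ℕ
  storedBits v = w * length (label v)

module Routing {n : ℕ} {G : Graph n} {w : ℕ} (P : Program) (S : Scheme G w) where
  open Graph G using (_~_)
  open Scheme S

  -- Within f steps, P decides to forward a message for t from s to v.
  ForwardsIn : ℕ → (s t v : Fin n) → Set
  ForwardsIn f s t v = s ~ v × run w P (label s) (label t) f ≡ just (port s v)

  Forwards : (s t v : Fin n) → Set
  Forwards s t v = ∃[ f ] ForwardsIn f s t v

  -- Route t s m: the message for t starting at s reaches t after m hops.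
  data Route (t : Fin n) : Fin n → ℕ → Set where
    arrived : Route t t 0
    hop     : ∀ {s v m} → s ≢ t → Forwards s t v → Route t v m → Route t s (suc m)

  GreedyWrt : (Fin n → Fin n → ℝ) → Set
  GreedyWrt d = ∀ {s t v} → s ≢ t → Forwards s t v → d v t <ᵣ d s t

  StarvationFree : Set
  StarvationFree = ∀ s t → s ≢ t → (∃[ v ] Forwards s t v) × (∃[ m ] Route t s m)

  HasStretch : (c ℓ : ℝ) → Set
  HasStretch c ℓ = ∀ {s t a m} → s ≢ t → Route t s a → Distance _~_ s t m → WithinStretch c ℓ a m

  DecisionTime≤ : ℕ → Set
  DecisionTime≤ f = ∀ s t → s ≢ t → ∃[ v ] ForwardsIn f s t v

-- Words of Θ(log n + log k) bits; the summand 1 avoids words of no bits.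
wordSize : (A n k : ℕ) → ℕ
wordSize A n k = A * (1 + ⌊log₂ n ⌋ + ⌊log₂ k ⌋)

{-# OPTIONS --safe #-}
module Submission where

-- Let d(s,t) be the least distance of s and t within a tree of the cover.  The
-- program finds a tree attaining it and forwards along that tree.  This lowers
-- d by at least one, so the routed path has at most d(s,t) edges, which the
-- cover bounds.
--
-- To measure distances within one tree, the vertices are halved repeatedly: for
-- every vertex set W with at least two elements there are a hub c and a union S
-- of branches at c such that S contains between a quarter and three quarters of
-- W.  A path leaving S enters c, so c lies between the two parts.  Hence each
-- vertex gets a key of O(log n) bits, saying in which part it falls at each
-- level, together with its distance to the hub of each level and the ports at
-- both ends of the path between them.  The first level i where the keys of s
-- and t differ is the lowest set bit 2^i of their xor, and 2^i mod 3^e is a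
-- collision-free table index of size O(log n) because 2 is a primitive root
-- modulo 3^e.
--
-- If k ≤ n³, then log k = O(log n) and all trees are stored.  Otherwise n² trees
-- suffice, one for each pair of vertices, and k is so large that storing them
-- in words of Θ(log n + log k) bits stays within the bound.

open import Defs
open import Data.Bool using (Bool; true; false; if_then_else_; _∧_) renaming (_xor_ to _⊻_)
open import Data.Bool.Properties using (T-≡; xor-same)
open import Data.Empty using (⊥; ⊥-elim)
open import Data.Fin as Fin using (Fin; toℕ; fromℕ<; remQuot; combine)
import Data.Fin.Properties as Fin
open import Data.Fin.Subset using (Subset) renaming (_∈_ to _∈ₛ_)
open import Data.Fin.Subset.Properties using () renaming (_∈?_ to _∈ₛ?_)
import Data.Integer as ℤ
import Data.Integer.Properties as ℤ
open import Data.List using (List; []; _∷_; _++_; length; map; foldr; drop; head; applyUpTo; filter; allFin; lookup)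
open import Data.List.Extrema.Nat using (min; min≤v⁺; v≤min⁺)
open import Data.List.Membership.DecPropositional as DecMembership using ()
open import Data.List.Membership.Propositional using (_∈_; _∉_; lose)
open import Data.List.Membership.Propositional.Properties using (∈-filter⁺; ∈-filter⁻; ∈-allFin; ∈-lookup; ∈-map⁺)
open import Data.List.Properties using (length-filter; filter-none; filter-all; filter-some; drop-drop; drop-map; length-drop; length-++; length-applyUpTo; drop-all; length-map; map-tabulate; tabulate-lookup; length-tabulate)
open import Data.List.Relation.Unary.All as All using (All; []; _∷_)
import Data.List.Relation.Unary.All.Properties as All
open import Data.List.Relation.Unary.AllPairs using ([]; _∷_)
open import Data.List.Relation.Unary.Any as Any using (Any; here; there; tail)
import Data.List.Relation.Unary.Any.Properties as Any
open import Data.List.Relation.Unary.Unique.Propositional using (Unique)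
import Data.List.Relation.Unary.Unique.Propositional.Properties as Unique
open import Data.Maybe using (just; maybe)
open import Data.Maybe.Properties using (just-injective)
open import Data.Nat using (ℕ; zero; suc; _+_; _*_; _∸_; _^_; _≤_; _<_; z≤n; s≤s; _/_; _%_; NonZero; >-nonZero; _≤?_; _≟_; _<?_; _<ᵇ_; _≡ᵇ_)
open import Data.Nat.DivMod hiding (_mod_; _div_)
open import Data.Nat.Divisibility
open import Data.Nat.Logarithm using (⌊log₂_⌋; ⌊log₂⌋-mono-≤; ⌊log₂[2^n]⌋≡n)
open import Data.Nat.Properties hiding (_≟_; _≤?_; _<?_)
open import Data.Nat.Tactic.RingSolver using (solve-∀)
open import Data.Product using (Σ-syntax; ∃-syntax; _×_; _,_; proj₁; proj₂)
import Data.Rational as ℚ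
import Data.Rational.Properties as ℚ
import Data.Rational.Unnormalised as ℚᵘ
import Data.Rational.Unnormalised.Properties as ℚᵘ
open import Data.Sum using (_⊎_; inj₁; inj₂; [_,_]′)
open import Function using (_∘_; id)
open import Function.Bundles using (Equivalence; mk⇔)
open import Level using (0ℓ)
open import Relation.Binary using (Rel; Symmetric; tri<; tri≈; tri>)
import Relation.Binary as B
open import Relation.Binary.Construct.Closure.ReflexiveTransitive as Star using (Star; ε; _◅_; _◅◅_)
open import Relation.Binary.PropositionalEquality hiding ([_])
open import Relation.Nullary using (¬_; Dec; yes; no; does)
open import Relation.Nullary.Decidable using (_×-dec_; _⊎-dec_; map′; dec-true; dec-false)
open import Relation.Unary using (Pred; Decidable)
open import Relation.Unary.Properties using (∁?)

-- Powers of 2 modulo powers of 3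

-- A decision may spend only constant time on each tree, but the instructions give neither the
-- position of a bit nor an associative lookup. Hashing 2^i replaces the former. For the latter,
-- scratch memory indexed by tree number records where the entries of s begin; it starts out zero
-- and no entry begins at address 0, so zero means that s is not in that tree. The second obstacle
-- is storage. Each tree takes order log n words, so K trees take order K log n (log n + log k)
-- bits, and the mixed term log n · log k is in general not dominated by log² n + log k. This forces
-- the case distinction on k.

4^m≡1+3* : ∀ m → ∃[ y ] 4 ^ m ≡ 1 + 3 * y
4^m≡1+3* zero    = 0 , refl
4^m≡1+3* (suc m) with 4^m≡1+3* m
... | y , eq = 1 + 4 * y , trans (cong (4 *_) eq) (carry y)
  where
  carry : ∀ y → 4 * (1 + 3 * y) ≡ 1 + 3 * (1 + 4 * y)
  carry = solve-∀

64^m≡1+9* : ∀ m → ∃[ y ] 64 ^ m ≡ 1 + 9 * y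
64^m≡1+9* zero    = 0 , refl
64^m≡1+9* (suc m) with 64^m≡1+9* m
... | y , eq = 7 + 64 * y , trans (cong (64 *_) eq) (carry y)
  where
  carry : ∀ y → 64 * (1 + 9 * y) ≡ 1 + 9 * (7 + 64 * y)
  carry = solve-∀

-- The factor 1 + 3u is invertible modulo 3. So 3 divides x as soon as it divides the product, and
-- the induction strips one factor 3 from both x and the divisor.
3^∣-cancel : ∀ e u x → 3 ^ e ∣ (1 + 3 * u) * x → 3 ^ e ∣ x
3^∣-cancel zero    u x _ = 1∣ x
3^∣-cancel (suc e) u x d with 3∣x
  where
  3∣x : 3 ∣ x
  3∣x = ∣m+n∣m⇒∣n {m = 3 * (u * x)}
          (subst (3 ∣_) (regroup u x) (∣-trans (m∣m*n (3 ^ e)) d)) (m∣m*n (u * x))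
    where
    regroup : ∀ u x → (1 + 3 * u) * x ≡ 3 * (u * x) + x
    regroup = solve-∀
... | divides-refl q =
  subst (3 ^ suc e ∣_) (*-comm 3 q) (*-monoʳ-∣ 3 (3^∣-cancel e u q
    (*-cancelˡ-∣ 3 (subst (3 ^ suc e ∣_) (shuffle u q) d))))
  where
  shuffle : ∀ u q → (1 + 3 * u) * (q * 3) ≡ 3 * ((1 + 3 * u) * q)
  shuffle = solve-∀

-- 4 has order 3 modulo 9: with d = r + 3q, the remainders r = 1 and r = 2 make z congruent to 3 and
-- to 6 modulo 9.
9∣4^d∸1⇒3∣d : ∀ d {z} → 4 ^ d ≡ 1 + z → 9 ∣ z → 3 ∣ d
9∣4^d∸1⇒3∣d d {z} eq 9∣z =
  remainder (d % 3) (m%n<n d 3) (m≡m%n+[m/n]*n d 3)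
  where
  q = d / 3
  y = let y , _ = 64^m≡1+9* q in y
  4^[r+3q] : ∀ r → d ≡ r + q * 3 → 1 + z ≡ 4 ^ r * (1 + 9 * y)
  4^[r+3q] r d≡ = begin
    1 + z                 ≡⟨ eq ⟨
    4 ^ d                 ≡⟨ cong (4 ^_) (trans d≡ (cong (r +_) (*-comm q 3))) ⟩
    4 ^ (r + 3 * q)       ≡⟨ ^-distribˡ-+-* 4 r (3 * q) ⟩
    4 ^ r * 4 ^ (3 * q)   ≡⟨ cong (4 ^ r *_) (^-*-assoc 4 3 q) ⟨
    4 ^ r * 64 ^ q        ≡⟨ cong (4 ^ r *_) (let _ , e = 64^m≡1+9* q in e) ⟩
    4 ^ r * (1 + 9 * y)   ∎
    where open ≡-Reasoning
  absurd : ∀ r a → z ≡ 9 * a + suc r → suc r < 9 → ⊥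
  absurd r a e r<9 = >⇒∤ r<9 (∣m+n∣m⇒∣n {m = 9 * a} (subst (9 ∣_) e 9∣z) (m∣m*n a))
  expand₁ : ∀ y → 4 * (1 + 9 * y) ≡ suc (9 * (4 * y) + 3)
  expand₁ = solve-∀
  expand₂ : ∀ y → 16 * (1 + 9 * y) ≡ suc (9 * (16 * y + 1) + 6)
  expand₂ = solve-∀
  remainder : ∀ r → r < 3 → d ≡ r + q * 3 → 3 ∣ d
  remainder 0 _ d≡ = divides q d≡
  remainder 1 _ d≡ = ⊥-elim (absurd 2 (4 * y)
    (suc-injective (trans (4^[r+3q] 1 d≡) (expand₁ y))) (s≤s (s≤s (s≤s (s≤s z≤n)))))
  remainder 2 _ d≡ = ⊥-elim (absurd 5 (16 * y + 1)
    (suc-injective (trans (4^[r+3q] 2 d≡) (expand₂ y)))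
    (s≤s (s≤s (s≤s (s≤s (s≤s (s≤s (s≤s z≤n))))))))
  remainder (suc (suc (suc r))) (s≤s (s≤s (s≤s ()))) _

private
  cube : ∀ y → (1 + 3 * y) * ((1 + 3 * y) * ((1 + 3 * y) * 1)) ≡ 1 + 3 * ((1 + 3 * (y + y * y)) * (3 * y))
  cube = solve-∀

-- Lifting the exponent: 4^{3q} ∸ 1 = 3 · (4^q ∸ 1) · u with u ≡ 1 mod 3.
3^∣4^d∸1⇒3^∣d : ∀ e d {z} → 4 ^ d ≡ 1 + z → 3 ^ suc e ∣ z → 3 ^ e ∣ d
3^∣4^d∸1⇒3^∣d zero    d eq dv = 1∣ d
3^∣4^d∸1⇒3^∣d (suc e) d {z} eq dv
  with 9∣4^d∸1⇒3∣d d eq (∣-trans (subst (9 ∣_) (*-assoc 3 3 (3 ^ e)) (m∣m*n (3 ^ e))) dv)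
... | divides-refl q with 4^m≡1+3* q
...   | y , eq′ = subst (3 ^ suc e ∣_) (*-comm 3 q) (*-monoʳ-∣ 3 (3^∣4^d∸1⇒3^∣d e q eq′
          (3^∣-cancel (suc e) (y + y * y) (3 * y)
            (*-cancelˡ-∣ 3 (subst (3 ^ suc (suc e) ∣_) z≡ dv)))))
  where
  z≡ : z ≡ 3 * ((1 + 3 * (y + y * y)) * (3 * y))
  z≡ = suc-injective (trans (sym eq) (trans (sym (^-*-assoc 4 q 3))
         (trans (cong (_^ 3) eq′) (cube y))))

%≡%⇒∣ : ∀ a x m .{{_ : NonZero m}} → a % m ≡ (a + x) % m → m ∣ x
%≡%⇒∣ a x m eq = ∣m+n∣m⇒∣n {m = a / m * m} (divides ((a + x) / m) (+-cancelˡ-≡ (a % m) _ _ (begin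
    a % m + (a / m * m + x)                ≡⟨ +-assoc (a % m) (a / m * m) x ⟨
    a % m + a / m * m + x                  ≡⟨ cong (_+ x) (m≡m%n+[m/n]*n a m) ⟨
    a + x                                  ≡⟨ m≡m%n+[m/n]*n (a + x) m ⟩
    (a + x) % m + (a + x) / m * m          ≡⟨ cong (_+ (a + x) / m * m) eq ⟨
    a % m + (a + x) / m * m                ∎)))
  (n∣m*n (a / m))
  where open ≡-Reasoning

private
  -- Equal residues give 3^(e+1) ∣ 2^i · z with z = 2^(d+1) ∸ 1. A further factor 2^i turns 2^i into
  -- 4^i, which is 1 modulo 3 and can be cancelled. Then 3^(e+1) divides z, hence also z(z + 2) =
  -- 4^(d+1) ∸ 1, and lifting the exponent yields 3^e ∣ d + 1, which is too small.
  2^i≢2^j-mod : ∀ e m {i d} → m ≡ 3 ^ suc e → .{{_ : NonZero m}} → suc d < 3 ^ e →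
                ¬ (2 ^ i % m ≡ 2 ^ (i + suc d) % m)
  2^i≢2^j-mod e m {i} {d} m≡ d< eq =
    <⇒≱ d< (∣⇒≤ (3^∣4^d∸1⇒3^∣d e (suc d) {z * (z + 2)} 4^d≡ (∣m⇒∣m*n (z + 2) 3^∣z)))
    where
    z = 2 ^ suc d ∸ 1
    2^d≡ : 2 ^ suc d ≡ 1 + z
    2^d≡ = sym (m+[n∸m]≡n (m^n>0 2 (suc d)))
    square : ∀ z → (1 + z) * ((1 + z) * 1) ≡ 1 + z * (z + 2)
    square = solve-∀
    4^d≡ : 4 ^ suc d ≡ 1 + z * (z + 2)
    4^d≡ = trans (^-*-assoc 2 2 (suc d)) (trans (cong (2 ^_) (*-comm 2 (suc d)))
             (trans (sym (^-*-assoc 2 (suc d) 2)) (trans (cong (_^ 2) 2^d≡) (square z))))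
    expand : 2 ^ (i + suc d) ≡ 2 ^ i + 2 ^ i * z
    expand = trans (^-distribˡ-+-* 2 i (suc d)) (trans (cong (2 ^ i *_) 2^d≡)
               (trans (*-distribˡ-+ (2 ^ i) 1 z) (cong (_+ 2 ^ i * z) (*-identityʳ (2 ^ i)))))
    4^i≡ : 2 ^ i * 2 ^ i ≡ 4 ^ i
    4^i≡ = trans (sym (^-distribˡ-+-* 2 i i)) (trans (cong (λ j → 2 ^ (i + j)) (sym (+-identityʳ i)))
             (sym (^-*-assoc 2 2 i)))
    3^∣z : 3 ^ suc e ∣ z
    3^∣z = let y , 4^i≡′ = 4^m≡1+3* i in
      3^∣-cancel (suc e) y z (subst (_∣ (1 + 3 * y) * z) m≡
        (subst (m ∣_) (trans (sym (*-assoc (2 ^ i) (2 ^ i) z)) (cong (_* z) (trans 4^i≡ 4^i≡′)))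
          (∣n⇒∣m*n (2 ^ i) (%≡%⇒∣ (2 ^ i) (2 ^ i * z) m
            (trans eq (cong (_% m) expand))))))

-- 2 has order 2 · 3^e modulo 3^{e+1}; half of that range suffices here.
2^-mod-injective : ∀ e m {i j} → m ≡ 3 ^ suc e → .{{_ : NonZero m}} → i < 3 ^ e → j < 3 ^ e →
                   2 ^ i % m ≡ 2 ^ j % m → i ≡ j
2^-mod-injective e m {i} {j} m≡ i< j< eq with <-cmp i j
... | tri≈ _ i≡j _ = i≡j
... | tri< i<j _ _ with m≤n⇒∃[o]m+o≡n i<j
...   | d , refl = ⊥-elim (2^i≢2^j-mod e m {i} {d} m≡
          (≤-<-trans (s≤s (m≤n+m d i)) j<) (trans eq (cong (λ j → 2 ^ j % m) (sym (+-suc i d)))))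
2^-mod-injective e m {i} {j} m≡ i< j< eq | tri> _ _ j<i with m≤n⇒∃[o]m+o≡n j<i
...   | d , refl = ⊥-elim (2^i≢2^j-mod e m {j} {d} m≡
          (≤-<-trans (s≤s (m≤n+m d j)) i<) (trans (sym eq) (cong (λ i → 2 ^ i % m) (sym (+-suc j d)))))

-- Bits of words

bit : Bool → ℕ
bit b = if b then 1 else 0

bit-%2 : ∀ b m → (bit b + 2 * m) % 2 ≡ bit b
bit-%2 b m = trans (cong (λ x → (bit b + x) % 2) (*-comm 2 m)) (trans ([m+kn]%n≡m%n (bit b) m 2) (small b))
  where
  small : ∀ b → bit b % 2 ≡ bit b
  small false = refl
  small true  = refl

bit-/2 : ∀ b m → (bit b + 2 * m) / 2 ≡ m
bit-/2 b m = trans (cong (λ x → (bit b + x) / 2) (*-comm 2 m))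
  (trans (+-distrib-/-∣ʳ (bit b) (n∣m*n m)) (trans (cong₂ _+_ (small b) (m*n/n≡m m 2)) refl))
  where
  small : ∀ b → bit b / 2 ≡ 0
  small false = refl
  small true  = refl

bit-injective : ∀ b c m n → bit b + 2 * m ≡ bit c + 2 * n → b ≡ c × m ≡ n
bit-injective b c m n eq =
  bit-inj b c (trans (sym (bit-%2 b m)) (trans (cong (_% 2) eq) (bit-%2 c n))) ,
  trans (sym (bit-/2 b m)) (trans (cong (_/ 2) eq) (bit-/2 c n))
  where
  bit-inj : ∀ b c → bit b ≡ bit c → b ≡ c
  bit-inj false false _ = refl
  bit-inj true  true  _ = refl

bitwise-bit : ∀ f w b c m n →
  bitwise f (suc w) (bit b + 2 * m) (bit c + 2 * n) ≡ bit (f b c) + 2 * bitwise f w m n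
bitwise-bit f w b c m n
  rewrite bit-%2 b m | bit-%2 c n | bit-/2 b m | bit-/2 c n = cong (_+ 2 * bitwise f w m n) (digit b c)
  where
  digit : ∀ b c → (if f (bit b ≡ᵇ 1) (bit c ≡ᵇ 1) then 1 else 0) ≡ bit (f b c)
  digit false false = refl
  digit false true  = refl
  digit true  false = refl
  digit true  true  = refl

data Bits : ℕ → Set where
  _∙_ : ∀ b m → Bits (bit b + 2 * m)

bits : ∀ a → Bits a
bits a = subst Bits (sym (m≡m%n+[m/n]*n a 2)) (lowest (a % 2) (m%n<n a 2))
  where
  lowest : ∀ r → r < 2 → Bits (r + a / 2 * 2)
  lowest 0 _ = subst Bits (*-comm 2 (a / 2)) (false ∙ (a / 2))
  lowest 1 _ = subst (Bits ∘ suc) (*-comm 2 (a / 2)) (true ∙ (a / 2))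
  lowest (suc (suc _)) (s≤s (s≤s ()))

-- Level 0 is the least significant bit, so that the first level at which two codes differ is the
-- lowest set bit of their xor.
encode : ℕ → (ℕ → Bool) → ℕ
encode zero    c = 0
encode (suc D) c = bit (c 0) + 2 * encode D (c ∘ suc)

encode<2^ : ∀ D c → encode D c < 2 ^ D
encode<2^ zero    c = s≤s z≤n
encode<2^ (suc D) c = begin
  suc (bit (c 0)) + 2 * encode D (c ∘ suc) ≤⟨ +-monoˡ-≤ _ (s≤s (bit≤1 (c 0))) ⟩
  2 + 2 * encode D (c ∘ suc)               ≡⟨ *-suc 2 _ ⟨
  2 * suc (encode D (c ∘ suc))             ≤⟨ *-monoʳ-≤ 2 (encode<2^ D (c ∘ suc)) ⟩
  2 * 2 ^ D                                ∎
  where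
  open ≤-Reasoning
  bit≤1 : ∀ b → bit b ≤ 1
  bit≤1 false = z≤n
  bit≤1 true  = s≤s z≤n

bitwise-0 : ∀ f → f false false ≡ false → ∀ w → bitwise f w 0 0 ≡ 0
bitwise-0 f ff zero    = refl
bitwise-0 f ff (suc w) =
  trans (bitwise-bit f w false false 0 0) (cong₂ (λ b m → bit b + 2 * m) ff (bitwise-0 f ff w))

bitwise-encode : ∀ f → f false false ≡ false → ∀ {D w} → D ≤ w → ∀ a b →
  bitwise f w (encode D a) (encode D b) ≡ encode D (λ i → f (a i) (b i))
bitwise-encode f ff {w = w} z≤n a b = bitwise-0 f ff w
bitwise-encode f ff {suc D} {suc w} (s≤s D≤w) a b =
  trans (bitwise-bit f w (a 0) (b 0) _ _)
        (cong (λ m → bit (f (a 0) (b 0)) + 2 * m) (bitwise-encode f ff D≤w (a ∘ suc) (b ∘ suc)))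

-- The form 2^i · (1 + 2y) expresses arithmetically that bit i is the lowest set bit; `∧-negate`
-- consumes it in this form.
encode-lowest : ∀ D i c → i < D → (∀ j → j < i → c j ≡ false) → c i ≡ true →
                ∃[ y ] encode D c ≡ 2 ^ i * (1 + 2 * y)
encode-lowest (suc D) zero    c _ low top = encode D (c ∘ suc) ,
  trans (cong (λ b → bit b + 2 * encode D (c ∘ suc)) top) (sym (*-identityˡ (1 + 2 * encode D (c ∘ suc))))
encode-lowest (suc D) (suc i) c (s≤s i<D) low top
  with encode-lowest D i (c ∘ suc) i<D (λ j j<i → low (suc j) (s≤s j<i)) top
... | y , eq = y , trans (cong₂ (λ b m → bit b + 2 * m) (low 0 (s≤s z≤n)) eq)
                         (sym (*-assoc 2 (2 ^ i) (1 + 2 * y)))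

-- Two numbers adding up to the all-ones word have different parities, and halving both preserves
-- the situation. So they never share a set bit.
∧-complement : ∀ w a b → suc (a + b) ≡ 2 ^ w → bitwise _∧_ w a b ≡ 0
∧-complement zero    a b _ = refl
∧-complement (suc w) a b eq with bits a | bits b
... | false ∙ m | false ∙ n = ⊥-elim (absurd (bit-injective true false (m + n) (2 ^ w)
        (trans (cong suc (*-distribˡ-+ 2 m n)) eq)))
  where absurd : ∀ {A : Set} → true ≡ false × A → ⊥
        absurd ()
... | true ∙ m | true ∙ n = ⊥-elim (absurd (bit-injective true false (suc (m + n)) (2 ^ w)
        (trans (shift m n) eq)))
  where absurd : ∀ {A : Set} → true ≡ false × A → ⊥
        absurd ()
        shift : ∀ m n → 1 + 2 * suc (m + n) ≡ suc (1 + 2 * m + (1 + 2 * n))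
        shift = solve-∀
... | false ∙ m | true ∙ n = trans (bitwise-bit _∧_ w false true m n)
        (cong (2 *_) (∧-complement w m n (*-cancelˡ-≡ _ _ 2 (trans (shift m n) eq))))
  where shift : ∀ m n → 2 * suc (m + n) ≡ suc (2 * m + (1 + 2 * n))
        shift = solve-∀
... | true ∙ m | false ∙ n = trans (bitwise-bit _∧_ w true false m n)
        (cong (2 *_) (∧-complement w m n (*-cancelˡ-≡ _ _ 2 (trans (shift m n) eq))))
  where shift : ∀ m n → 2 * suc (m + n) ≡ suc (1 + 2 * m + 2 * n)
        shift = solve-∀

-- Here b is the two's complement of a = 2^i · (1 + 2y): below bit i both are zero, at bit i both
-- are one, and above it they are complementary. The condition 0 < b rules out a = 2^w, which is not
-- a word.
∧-negate : ∀ w i y b → 0 < b → 2 ^ i * (1 + 2 * y) + b ≡ 2 ^ w →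
           bitwise _∧_ w (2 ^ i * (1 + 2 * y)) b ≡ 2 ^ i
∧-negate zero i y (suc b) _ eq = ⊥-elim (<⇒≢ (s≤s (≤-trans (*-mono-≤ (m^n>0 2 i) (s≤s (z≤n {2 * y})))
  (m≤m+n _ b))) (sym (trans (sym (+-suc _ b)) eq)))
∧-negate (suc w) zero y b 0<b eq with bits b
... | false ∙ n = ⊥-elim (absurd (bit-injective true false (y + n) (2 ^ w) (trans (shift y n) eq)))
  where absurd : ∀ {A : Set} → true ≡ false × A → ⊥
        absurd ()
        shift : ∀ y n → 1 + 2 * (y + n) ≡ 1 * (1 + 2 * y) + 2 * n
        shift = solve-∀
... | true ∙ n = trans (cong (λ x → bitwise _∧_ (suc w) x (1 + 2 * n)) (*-identityˡ (1 + 2 * y)))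
  (trans (bitwise-bit _∧_ w true true y n)
         (cong (λ m → 1 + 2 * m) (∧-complement w y n (*-cancelˡ-≡ _ _ 2 (trans (shift y n) eq)))))
  where shift : ∀ y n → 2 * suc (y + n) ≡ 1 * (1 + 2 * y) + (1 + 2 * n)
        shift = solve-∀
∧-negate (suc w) (suc i) y b 0<b eq with bits b
... | true ∙ n = ⊥-elim (absurd (bit-injective true false (2 ^ i * (1 + 2 * y) + n) (2 ^ w)
        (trans (shift (2 ^ i) y n) eq)))
  where absurd : ∀ {A : Set} → true ≡ false × A → ⊥
        absurd ()
        shift : ∀ p y n → 1 + 2 * (p * (1 + 2 * y) + n) ≡ 2 * p * (1 + 2 * y) + (1 + 2 * n)
        shift = solve-∀
... | false ∙ n = trans (cong (λ x → bitwise _∧_ (suc w) x (2 * n)) (*-assoc 2 (2 ^ i) (1 + 2 * y)))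
  (trans (bitwise-bit _∧_ w false false (2 ^ i * (1 + 2 * y)) n)
         (cong (2 *_) (∧-negate w i y n (0<n n 0<b) (*-cancelˡ-≡ _ _ 2 (trans (shift (2 ^ i) y n) eq)))))
  where shift : ∀ p y n → 2 * (p * (1 + 2 * y) + n) ≡ 2 * p * (1 + 2 * y) + 2 * n
        shift = solve-∀
        0<n : ∀ n → 0 < 2 * n → 0 < n
        0<n (suc n) _ = s≤s z≤n

trunc-< : ∀ w {a} → a < 2 ^ w → trunc w a ≡ a
trunc-< w a< = m<n⇒m%n≡m {{m^n≢0 2 w}} a<

lowest-set-bit : ∀ {D w i} a b → D ≤ w → i < D → (∀ j → j < i → a j ≡ b j) → a i ≢ b i →
  let z = ⟦ xor ⟧ w (encode D a) (encode D b) in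
  ⟦ and ⟧ w z (⟦ sub ⟧ w 0 z) ≡ 2 ^ i
lowest-set-bit {D} {w} {i} a b D≤w i<D agree differ
  with encode-lowest D i (λ j → a j ⊻ b j) i<D
         (λ j j<i → trans (cong (_⊻ b j) (agree j j<i)) (xor-same (b j)))
         (xor-differ (a i) (b i) differ)
  where
  xor-differ : ∀ p q → p ≢ q → p ⊻ q ≡ true
  xor-differ false false ne = ⊥-elim (ne refl)
  xor-differ false true  _  = refl
  xor-differ true  false _  = refl
  xor-differ true  true  ne = ⊥-elim (ne refl)
... | y , eq
  rewrite bitwise-encode _⊻_ refl D≤w a b =
  -- Since z is positive, the negation 2^w ∸ z is already a word and `sub` truncates nothing.
  trans (cong (bitwise _∧_ w z) (trunc-< w (∸-monoʳ-< 0<z (<⇒≤ z<2^w)))) (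
  trans (cong (λ x → bitwise _∧_ w x (2 ^ w ∸ z)) eq)
        (∧-negate w i y (2 ^ w ∸ z) (m<n⇒0<n∸m z<2^w)
          (trans (cong (_+ (2 ^ w ∸ z)) (sym eq)) (m+[n∸m]≡n (<⇒≤ z<2^w)))))
  where
  z = encode D (λ j → a j ⊻ b j)
  z<2^w : z < 2 ^ w
  z<2^w = <-≤-trans (encode<2^ D _) (^-monoʳ-≤ 2 D≤w)
  0<z : 0 < z
  0<z = subst (0 <_) (sym eq) (*-mono-≤ (m^n>0 2 i) (s≤s (z≤n {2 * y})))

-- Searching and counting

-- An unsuccessful search returns the bound itself, so success is recognised by a value strictly
-- below it.
least : {P : ℕ → Set} → Decidable P → ℕ → ℕ
least P? zero    = 0
least P? (suc b) with P? 0
... | yes _ = 0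
... | no  _ = suc (least (P? ∘ suc) b)

least≤bound : {P : ℕ → Set} (P? : Decidable P) → ∀ b → least P? b ≤ b
least≤bound P? zero    = z≤n
least≤bound P? (suc b) with P? 0
... | yes _ = z≤n
... | no  _ = s≤s (least≤bound (P? ∘ suc) b)

least-holds : {P : ℕ → Set} (P? : Decidable P) → ∀ b → least P? b < b → P (least P? b)
least-holds P? (suc b) l<b with P? 0
... | yes p = p
least-holds P? (suc b) (s≤s l<b) | no _ = least-holds (P? ∘ suc) b l<b

least≤ : {P : ℕ → Set} (P? : Decidable P) → ∀ b {i} → P i → least P? b ≤ i
least≤ P? zero    p = z≤n
least≤ P? (suc b) p with P? 0
least≤ P? (suc b) {i}     p | yes _ = z≤n
least≤ P? (suc b) {zero}  p | no ¬p = ⊥-elim (¬p p)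
least≤ P? (suc b) {suc i} p | no _  = s≤s (least≤ (P? ∘ suc) b p)

module _ {a} {A : Set a} where

  count : {P : Pred A 0ℓ} → Decidable P → List A → ℕ
  count P? xs = length (filter P? xs)

  count-∪ : {P Q R : Pred A 0ℓ} (P? : Decidable P) (Q? : Decidable Q) (R? : Decidable R) →
            ∀ {xs} → All (λ x → P x → Q x ⊎ R x) xs → count P? xs ≤ count Q? xs + count R? xs
  count-∪ P? Q? R? [] = z≤n
  count-∪ P? Q? R? {x ∷ xs} (f ∷ fs) with count-∪ P? Q? R? fs | P? x | Q? x | R? x
  ... | ih | no _  | no _  | no _  = ih
  ... | ih | no _  | no _  | yes _ = ≤-trans ih (+-monoʳ-≤ (count Q? xs) (n≤1+n _))
  ... | ih | no _  | yes _ | no _  = m≤n⇒m≤1+n ih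
  ... | ih | no _  | yes _ | yes _ = m≤n⇒m≤1+n (≤-trans ih (+-monoʳ-≤ (count Q? xs) (n≤1+n _)))
  ... | ih | yes _ | yes _ | no _  = s≤s ih
  ... | ih | yes _ | yes _ | yes _ = s≤s (≤-trans ih (+-monoʳ-≤ (count Q? xs) (n≤1+n _)))
  ... | ih | yes _ | no _  | yes _ = ≤-trans (s≤s ih) (≤-reflexive (sym (+-suc (count Q? xs) _)))
  ... | ih | yes p | no ¬q | no ¬r = ⊥-elim ([ ¬q , ¬r ]′ (f p))

  count-∁ : {P : Pred A 0ℓ} (P? : Decidable P) → ∀ xs → count P? xs + count (∁? P?) xs ≡ length xs
  count-∁ P? [] = refl
  count-∁ P? (x ∷ xs) with P? x
  ... | yes _ = cong suc (count-∁ P? xs)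
  ... | no _  = trans (+-suc _ _) (cong suc (count-∁ P? xs))

  count-mono : {P Q : Pred A 0ℓ} (P? : Decidable P) (Q? : Decidable Q) → (∀ {x} → P x → Q x) →
               ∀ xs → count P? xs ≤ count Q? xs
  count-mono P? Q? P⊆Q [] = z≤n
  count-mono P? Q? P⊆Q (x ∷ xs) with P? x | Q? x
  ... | no _  | no _  = count-mono P? Q? P⊆Q xs
  ... | no _  | yes _ = m≤n⇒m≤1+n (count-mono P? Q? P⊆Q xs)
  ... | yes _ | yes _ = s≤s (count-mono P? Q? P⊆Q xs)
  ... | yes p | no ¬q = ⊥-elim (¬q (P⊆Q p))

  count-none : {P : Pred A 0ℓ} (P? : Decidable P) → (∀ x → ¬ P x) → ∀ xs → count P? xs ≡ 0
  count-none P? ¬P xs = cong length (filter-none P? (All.universal ¬P xs))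

  count-filter : {P Q : Pred A 0ℓ} (P? : Decidable P) (Q? : Decidable Q) →
                 ∀ xs → count P? (filter Q? xs) ≤ count P? xs
  count-filter P? Q? [] = z≤n
  count-filter P? Q? (x ∷ xs) with Q? x
  count-filter P? Q? (x ∷ xs) | yes _ with P? x
  ... | yes _ = s≤s (count-filter P? Q? xs)
  ... | no _  = count-filter P? Q? xs
  count-filter P? Q? (x ∷ xs) | no _ with P? x
  ... | yes _ = m≤n⇒m≤1+n (count-filter P? Q? xs)
  ... | no _  = count-filter P? Q? xs

count-map : ∀ {a b} {A : Set a} {B : Set b} {P : Pred B 0ℓ} (P? : Decidable P) (f : A → B) →
            ∀ xs → count (P? ∘ f) xs ≡ count P? (map f xs)
count-map P? f [] = refl
count-map P? f (x ∷ xs) with P? (f x)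
... | yes _ = cong suc (count-map P? f xs)
... | no _  = count-map P? f xs

-- Removing the elements related to the first y costs at most k, and the others remain related to
-- one of the later ys.
double-counting : ∀ {a} {A : Set a} {B : Set} {R : A → B → Set} (R? : ∀ y → Decidable (λ x → R x y)) k →
  ∀ ys xs → (∀ y → count (R? y) xs ≤ k) → All (λ x → Any (R x) ys) xs → length xs ≤ length ys * k
double-counting R? k []       []      _    _        = z≤n
double-counting R? k []       (_ ∷ _) _    (() ∷ _)
double-counting R? k (y ∷ ys) xs      few  related  = begin
  length xs                                    ≡⟨ count-∁ (R? y) xs ⟨
  count (R? y) xs + count (∁? (R? y)) xs       ≤⟨ +-mono-≤ (few y) (double-counting R? k ys _
      (λ z → ≤-trans (count-filter (R? z) (∁? (R? y)) xs) (few z))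
      (All.zipWith (λ (¬r , r) → tail ¬r r) (All.all-filter (∁? (R? y)) xs , All.filter⁺ (∁? (R? y)) related))) ⟩
  k + length ys * k                            ∎
  where open ≤-Reasoning

count-≡ : ∀ {n} (j : Fin n) {xs} → Unique xs → count (Fin._≟ j) xs ≤ 1
count-≡ j [] = z≤n
count-≡ j {x ∷ xs} (x∉xs ∷ u) with x Fin.≟ j
... | no _     = count-≡ j u
... | yes refl = ≤-reflexive (cong suc (cong length (filter-none (Fin._≟ j) (All.map (_∘ sym) x∉xs))))

unique-length : ∀ {n} {xs : List (Fin n)} → Unique xs → length xs ≤ n
unique-length {n} {xs} u = ≮⇒≥ λ n<len →
  let i , j , i<j , eq = Fin.pigeonhole n<len (lookup xs) in distinct u i j i<j eq
  where
  distinct : ∀ {xs : List (Fin n)} → Unique xs → ∀ i j → i Fin.< j → lookup xs i ≢ lookup xs j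
  distinct (x∉xs ∷ _) Fin.zero    (Fin.suc j) _         = All.lookup x∉xs (∈-lookup j)
  distinct (_ ∷ u)    (Fin.suc i) (Fin.suc j) (s≤s i<j) = distinct u i j i<j

-- Paths, distances and rooted trees

module _ {n : ℕ} {E : Rel (Fin n) 0ℓ} where

  length-vertices : ∀ {s t} (p : Star E s t) → length (vertices p) ≡ suc (edges p)
  length-vertices ε       = refl
  length-vertices (_ ◅ p) = cong suc (length-vertices p)

  len<n : ∀ {s t} (p : Path E s t) → len p < n
  len<n p = subst (_≤ n) (length-vertices (Path.walk p)) (unique-length (Path.simple p))

  suffix : ∀ {s t x} (p : Star E s t) → Unique (vertices p) → x ∈ vertices p → Path E x t
  suffix ε       u       (here refl) = path ε u
  suffix (e ◅ p) u       (here refl) = path (e ◅ p) u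
  suffix (e ◅ p) (_ ∷ u) (there x∈p) = suffix p u x∈p

  loop-erase : ∀ {s t} → Star E s t → Path E s t
  loop-erase ε = path ε ([] ∷ [])
  loop-erase {s} (e ◅ p) with loop-erase p
  ... | path q u with s ∈? vertices q
    where open DecMembership Fin._≟_
  ...   | yes s∈q = suffix q u s∈q
  ...   | no  s∉q = path (e ◅ q) (All.¬Any⇒All¬ _ s∉q ∷ u)

module _ {n : ℕ} {E F : Rel (Fin n) 0ℓ} (f : ∀ {u v} → E u v → F u v) where

  vertices-map : ∀ {s t} (p : Star E s t) → vertices (Star.map {U = F} f p) ≡ vertices p
  vertices-map ε           = refl
  vertices-map {s} (_ ◅ p) = cong (s ∷_) (vertices-map p)

  edges-map : ∀ {s t} (p : Star E s t) → edges (Star.map {U = F} f p) ≡ edges p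
  edges-map ε       = refl
  edges-map (_ ◅ p) = cong suc (edges-map p)

  mapPath : ∀ {s t} → Path E s t → Path F s t
  mapPath (path p u) = path (Star.map f p) (subst Unique (sym (vertices-map p)) u)

module Distances {n : ℕ} (E : Rel (Fin n) 0ℓ) (E? : B.Decidable E) (E-sym : Symmetric E) where

  -- With the length fixed, existence of a walk is decidable by finite search, which makes the
  -- distance computable. Repeated vertices do not affect a minimum.
  Walk : ℕ → Fin n → Fin n → Set
  Walk zero    s t = s ≡ t
  Walk (suc m) s t = ∃[ v ] E s v × Walk m v t

  walk? : ∀ m s t → Dec (Walk m s t)
  walk? zero    s t = s Fin.≟ t
  walk? (suc m) s t = Fin.any? λ v → E? s v ×-dec walk? m v t

  walk : ∀ {s t} (p : Star E s t) → Walk (edges p) s t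
  walk ε       = refl
  walk (e ◅ p) = _ , e , walk p

  _++ʷ_ : ∀ {a b s u t} → Walk a s u → Walk b u t → Walk (a + b) s t
  _++ʷ_ {zero}  refl        q = q
  _++ʷ_ {suc a} (v , e , p) q = v , e , (p ++ʷ q)

  reverseʷ : ∀ {m s t} → Walk m s t → Walk m t s
  reverseʷ {zero}  refl        = refl
  reverseʷ {suc m} {s} {t} (v , e , p) =
    subst (λ m → Walk m t s) (+-comm m 1) (reverseʷ {m} p ++ʷ (s , E-sym e , refl))

  -- Unreachable pairs get the value n, which exceeds every actual distance.
  dist : Fin n → Fin n → ℕ
  dist s t = least (λ m → walk? m s t) n

  dist≤n : ∀ s t → dist s t ≤ n
  dist≤n s t = least≤bound (λ m → walk? m s t) n

  shortest : ∀ {s t} → dist s t < n → Walk (dist s t) s t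
  shortest {s} {t} = least-holds (λ m → walk? m s t) n

  dist≤ : ∀ {m s t} → Walk m s t → dist s t ≤ m
  dist≤ {m} {s} {t} = least≤ (λ m → walk? m s t) n

  dist-refl : ∀ s → dist s s ≡ 0
  dist-refl s = n≤0⇒n≡0 (dist≤ {0} refl)

  dist≡0⇒≡ : ∀ {s t} → dist s t ≡ 0 → s ≡ t
  dist≡0⇒≡ {s} {t} eq = subst (λ m → Walk m s t) eq
    (shortest (subst (_< n) (sym eq) (≤-<-trans z≤n (Fin.toℕ<n s))))

  dist-triangle : ∀ s u t → dist s t ≤ dist s u + dist u t
  dist-triangle s u t with m≤n⇒m<n∨m≡n (dist≤n s u) | m≤n⇒m<n∨m≡n (dist≤n u t)
  ... | inj₁ su<n | inj₁ ut<n = dist≤ {dist s u + dist u t} (shortest su<n ++ʷ shortest ut<n)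
  ... | inj₂ su≡n | _         = ≤-trans (dist≤n s t) (≤-trans (≤-reflexive (sym su≡n)) (m≤m+n _ _))
  ... | inj₁ _    | inj₂ ut≡n = ≤-trans (dist≤n s t) (≤-trans (≤-reflexive (sym ut≡n)) (m≤n+m _ _))

  dist-sym : ∀ s t → dist s t ≡ dist t s
  dist-sym s t = ≤-antisym (half s t) (half t s)
    where
    half : ∀ s t → dist s t ≤ dist t s
    half s t with m≤n⇒m<n∨m≡n (dist≤n t s)
    ... | inj₁ ts<n = dist≤ {dist t s} (reverseʷ (shortest ts<n))
    ... | inj₂ ts≡n = ≤-trans (dist≤n s t) (≤-reflexive (sym ts≡n))

  closer? : ∀ s t v → Dec (E s v × suc (dist v t) ≡ dist s t)
  closer? s t v = E? s v ×-dec suc (dist v t) ≟ dist s t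

  -- The value s is a dummy for s ≡ t and for unreachable t.
  hop : Fin n → Fin n → Fin n
  hop s t with Fin.any? (closer? s t)
  ... | yes (v , _) = v
  ... | no _        = s

  hop-self : ∀ s → hop s s ≡ s
  hop-self s with Fin.any? (closer? s s)
  ... | no _               = refl
  ... | yes (v , _ , eq) with trans eq (dist-refl s)
  ...   | ()

  hop-closer : ∀ {s t} → dist s t < n → s ≢ t → E s (hop s t) × suc (dist (hop s t) t) ≡ dist s t
  hop-closer {s} {t} st<n s≢t with Fin.any? (closer? s t)
  ... | yes (_ , p) = p
  ... | no none = ⊥-elim (first (dist s t) refl (shortest st<n))
    where
    first : ∀ m → dist s t ≡ m → Walk m s t → ⊥
    first zero    _  s≡t         = s≢t s≡t
    first (suc m) eq (v , e , p) = none (v , e , ≤-antisym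
      (≤-trans (s≤s (dist≤ {m} p)) (≤-reflexive (sym eq)))
      (dist≤ (v , e , shortest (≤-<-trans (dist≤ {m} p) (<-trans (n<1+n m) (subst (_< n) eq st<n))))))

  module _ {P : Fin n → Set} (P? : Decidable P) {c : Fin n}
           (exit : ∀ {u v} → E u v → P u → ¬ P v → v ≡ c) where

    split-at-exit : ∀ m {s t} → P s → ¬ P t → Walk m s t →
                    ∃[ a ] ∃[ b ] a + b ≡ m × Walk a s c × Walk b c t
    split-at-exit zero    ps ¬pt refl        = ⊥-elim (¬pt ps)
    split-at-exit (suc m) ps ¬pt (v , e , p) with P? v
    ... | no ¬pv = 1 , m , refl , (v , e , exit e ps ¬pv) , subst (λ v → Walk m v _) (exit e ps ¬pv) p
    ... | yes pv with split-at-exit m pv ¬pt p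
    ...   | a , b , refl , q , r = suc a , b , refl , (v , e , q) , r

    dist-via-exit : ∀ {s t} → P s → ¬ P t → dist s t < n → dist s t ≡ dist s c + dist c t
    dist-via-exit {s} {t} ps ¬pt st<n with split-at-exit _ ps ¬pt (shortest st<n)
    ... | a , b , eq , p , q = ≤-antisym (dist-triangle s c t)
            (≤-trans (+-mono-≤ (dist≤ {a} p) (dist≤ {b} q)) (≤-reflexive eq))

module RootedTree {n : ℕ} {G : Graph n} (H : Subgraph G) (tree : IsTree H) where
  open Graph G using (~-irrefl)
  open Subgraph H
  open IsTree tree
  open Distances Edge Edge? Edge-sym public

  dist<n : ∀ {s t} → s ∈ₛ V → t ∈ₛ V → dist s t < n
  dist<n s∈V t∈V = let p = connected s∈V t∈V in
    ≤-<-trans (dist≤ {len p} (walk (Path.walk p))) (len<n p)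

  root : Fin n
  root = proj₁ nonempty

  parent : Fin n → Fin n
  parent v = hop v root

  depth : Fin n → ℕ
  depth v = dist v root

  parent-edge : ∀ {v} → v ∈ₛ V → v ≢ root → Edge v (parent v) × suc (depth (parent v)) ≡ depth v
  parent-edge v∈V v≢r = hop-closer (dist<n v∈V (proj₂ nonempty)) v≢r

  module _ {u v : Fin n} (e : Edge u v) (u↛v : parent u ≢ v) (v↛u : parent v ≢ u) where

    private
      Edge′ : Rel (Fin n) 0ℓ
      Edge′ x y = Edge x y × ¬ (x ≡ u × y ≡ v) × ¬ (x ≡ v × y ≡ u)

      Edge′-sym : Symmetric Edge′
      Edge′-sym (e , p , q) = Edge-sym e , (λ (a , b) → q (b , a)) , (λ (a , b) → p (b , a))

      ascend : ∀ m {x} → depth x ≡ m → x ∈ₛ V → Star Edge′ x root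
      ascend zero    eq x∈V = subst (Star Edge′ _) (dist≡0⇒≡ eq) ε
      ascend (suc m) {x} eq x∈V with x Fin.≟ root
      ... | yes refl = ε
      ... | no x≢r with parent-edge x∈V x≢r
      ...   | f , d = (f , (λ { (refl , p) → u↛v p }) , (λ { (refl , p) → v↛u p })) ◅
                      ascend m (suc-injective (trans d eq)) (Edge⊆V (Edge-sym f))

      detour : Path Edge′ u v
      detour = loop-erase (ascend _ refl (Edge⊆V e) ◅◅
                           Star.reverse Edge′-sym (ascend _ refl (Edge⊆V (Edge-sym e))))

      2≤len : ∀ (p : Path Edge′ u v) → 2 ≤ len p
      2≤len (path ε _)           = ⊥-elim (~-irrefl refl (Edge⊆G e))
      2≤len (path (f ◅ ε) _)     = ⊥-elim (proj₁ (proj₂ f) (refl , refl))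
      2≤len (path (_ ◅ _ ◅ _) _) = s≤s (s≤s z≤n)

    -- If neither end is the parent of the other, both ends climb to the root along parent edges
    -- without using this edge. Joining the two climbs and erasing loops gives a path that the edge
    -- closes to a cycle.
    non-tree-edge : ⊥
    non-tree-edge = acyclic (mapPath proj₁ detour)
      (subst (2 ≤_) (sym (edges-map proj₁ (Path.walk detour))) (2≤len detour)) (Edge-sym e)

  -- At the root and outside the tree `hop` returns its own argument; the depth condition keeps such
  -- vertices from being their own children.
  ChildOf : Fin n → Fin n → Set
  ChildOf c u = parent u ≡ c × depth u ≡ suc (depth c)

  childOf? : ∀ c u → Dec (ChildOf c u)
  childOf? c u = parent u Fin.≟ c ×-dec depth u ≟ suc (depth c)

  parent⇒depth : ∀ {u v} → Edge u v → parent u ≡ v → depth u ≡ suc (depth v)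
  parent⇒depth {u} e refl with u Fin.≟ root
  ... | yes refl = ⊥-elim (~-irrefl (sym (hop-self u)) (Edge⊆G e))
  ... | no u≢r   = sym (proj₂ (parent-edge (Edge⊆V e) u≢r))

  edge⇒child : ∀ {u v} → Edge u v → ChildOf v u ⊎ ChildOf u v
  edge⇒child {u} {v} e with parent u Fin.≟ v | parent v Fin.≟ u
  ... | yes p | _     = inj₁ (p , parent⇒depth e p)
  ... | no _  | yes q = inj₂ (q , parent⇒depth (Edge-sym e) q)
  ... | no p  | no q  = ⊥-elim (non-tree-edge e p q)

  -- The vertices below those children of c whose number is at least j.  These
  -- sets are the subtrees of the left-child right-sibling binary tree.
  data Branches (c : Fin n) (j : ℕ) : Fin n → Set where
    child : ∀ {u} → ChildOf c u → j ≤ toℕ u → Branches c j u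
    below : ∀ {u v} → ChildOf v u → Branches c j v → Branches c j u

  branches? : ∀ c j u → Dec (Branches c j u)
  branches? c j u = decide (depth u) u refl
    where
    decide : ∀ m u → depth u ≡ m → Dec (Branches c j u)
    decide zero u eq = no λ
      { (child (_ , d) _) → 0≢1+n (trans (sym eq) d)
      ; (below (_ , d) _) → 0≢1+n (trans (sym eq) d) }
    decide (suc m) u eq with childOf? c u ×-dec j ≤? toℕ u | childOf? (parent u) u
    ... | yes (ch , j≤u) | _ = yes (child ch j≤u)
    ... | no ¬ch | no ¬p     = no λ
      { (child ch j≤u)       → ¬ch (ch , j≤u)
      ; (below (refl , d) _) → ¬p (refl , d) }
    ... | no ¬ch | yes p     = map′ (below p)
      (λ { (child ch j≤u) → ⊥-elim (¬ch (ch , j≤u)) ; (below (refl , _) b) → b })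
      (decide m (parent u) (suc-injective (trans (sym (proj₂ p)) eq)))

  -- The set is closed under taking children, so an edge that leaves it goes up to a parent. The
  -- parent of a member is again a member unless the member is itself a child of c.
  branches-exit : ∀ {c j u v} → Edge u v → Branches c j u → ¬ Branches c j v → v ≡ c
  branches-exit e b ¬b with edge⇒child e
  branches-exit e b ¬b                      | inj₂ v<u          = ⊥-elim (¬b (below v<u b))
  branches-exit e (child (p , _) _) ¬b      | inj₁ (q , _)      = trans (sym q) p
  branches-exit e (below (refl , _) b) ¬b   | inj₁ (refl , _)   = ⊥-elim (¬b b)

  branches⇒<n : ∀ {c j u} → Branches c j u → j < n
  branches⇒<n (child {u} _ j≤u) = ≤-<-trans j≤u (Fin.toℕ<n u)
  branches⇒<n (below _ b)       = branches⇒<n b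

  -- One node of the binary tree: the child x numbered j, its left subtree `Branches x 0`, and the
  -- subtree `Branches c (suc j)` of its later siblings. The proofs of `ChildOf c x` discard the
  -- first two parts when x is not a child of c.
  branches-split : ∀ {c j u} (x : Fin n) → toℕ x ≡ j → Branches c j u →
                   (u ≡ x × ChildOf c x) ⊎ (ChildOf c x × Branches x 0 u) ⊎ Branches c (suc j) u
  branches-split x refl (child {u} ch j≤u) with m≤n⇒m<n∨m≡n j≤u
  ... | inj₁ j<u = inj₂ (inj₂ (child ch j<u))
  ... | inj₂ j≡u with Fin.toℕ-injective j≡u
  ...   | refl = inj₁ (refl , ch)
  branches-split x refl (below ch b) with branches-split x refl b
  ... | inj₁ (refl , ch′)      = inj₂ (inj₁ (ch′ , child ch z≤n))
  ... | inj₂ (inj₁ (ch′ , b′)) = inj₂ (inj₁ (ch′ , below ch b′))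
  ... | inj₂ (inj₂ b′)         = inj₂ (inj₂ (below ch b′))

  root-branches : ∀ {u} → u ∈ₛ V → u ≡ root ⊎ Branches root 0 u
  root-branches {u} u∈V = climb (depth u) refl u∈V
    where
    climb : ∀ m {u} → depth u ≡ m → u ∈ₛ V → u ≡ root ⊎ Branches root 0 u
    climb zero    eq u∈V = inj₁ (dist≡0⇒≡ eq)
    climb (suc m) {u} eq u∈V with u Fin.≟ root
    ... | yes u≡r = inj₁ u≡r
    ... | no u≢r with parent-edge u∈V u≢r
    ...   | e , d with climb m {parent u} (suc-injective (trans d eq)) (Edge⊆V (Edge-sym e))
    ...     | inj₁ p≡r = inj₂ (child (p≡r , trans (sym d) (cong (suc ∘ depth) p≡r)) z≤n)
    ...     | inj₂ b   = inj₂ (below (refl , sym d) b)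

  -- Balanced branch sets

  module _ {W : List (Fin n)} (uniq : Unique W) (W⊆V : All (_∈ₛ V) W) (2≤W : 2 ≤ length W) where

    private
      m = length W

      # : Fin n → ℕ → ℕ
      # c j = count (branches? c j) W

    Balanced : Set
    Balanced = ∃[ c ] ∃[ j ] length W ≤ 4 * count (branches? c j) W
                           × 4 * count (branches? c j) W ≤ 3 * length W

    private
      -- A heavy set of size p consists of at most one node and two subtrees, the larger of size x.
      -- If 4x < m held, then 12x + 3 ≤ 3m < 4 + 8x would force x = 0 and 3m < 4; this is where m ≥
      -- 2 enters.
      heavy-half : ∀ p x → 3 * m < 4 * p → p ≤ 1 + (x + x) → m ≤ 4 * x
      heavy-half p x 3m<4p p≤ = ≮⇒≥ λ 4x<m → contradict x 4x<m
        (≤-trans 3m<4p (*-monoʳ-≤ 4 p≤))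
        where
        contradict : ∀ x → 4 * x < m → 3 * m < 4 * (1 + (x + x)) → ⊥
        contradict zero    _    3m<4 = <⇒≱ 3m<4 (≤-trans (s≤s (s≤s (s≤s (s≤s z≤n)))) (*-monoʳ-≤ 3 2≤W))
        contradict (suc x) 4x<m 3m<  = <⇒≱ 3m< (≤-trans
          (≤-trans (m≤m+n _ (3 + 4 * x)) (≤-reflexive (slack x))) (*-monoʳ-≤ 3 4x<m))
          where
          slack : ∀ x → 4 * (1 + (suc x + suc x)) + (3 + 4 * x) ≡ 3 * suc (4 * suc x)
          slack = solve-∀

      -- Descent in the binary tree towards the larger subtree, as long as the current set holds
      -- more than three quarters of W. The larger subtree of a heavy set always has at least a
      -- quarter, so the descent may stop once it is no longer heavy. Termination is lexicographic:
      -- a bounds the depth still possible below c, and b counts the vertex numbers still to be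
      -- tried as children of c.
      descend : ∀ a c → n < depth c + a → ∀ b j → j + b ≡ n → 3 * m < 4 * # c j → Balanced
      descend a c a-ok zero j refl heavy = ⊥-elim (n≮0 (subst (λ x → 3 * m < 4 * x)
        (count-none (branches? c j) (λ u br → <-irrefl (sym (+-identityʳ j)) (branches⇒<n br)) W) heavy))
      descend a c a-ok (suc b) j j+b heavy = step (childOf? c x)
        where
        j<n : j < n
        j<n = ≤-trans (≤-trans (s≤s (m≤m+n j b)) (≤-reflexive (sym (+-suc j b)))) (≤-reflexive j+b)
        x : Fin n
        x = fromℕ< j<n
        x≡j = Fin.toℕ-fromℕ< j<n
        next : 3 * m < 4 * # c (suc j) → Balanced
        next = descend a c a-ok b (suc j) (trans (sym (+-suc j b)) j+b)
        enter : ∀ a → n < depth c + a → ChildOf c x → 3 * m < 4 * # x 0 → Balanced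
        enter zero    a-ok _  _ = ⊥-elim (<⇒≱ a-ok (≤-trans (≤-reflexive (+-identityʳ _)) (dist≤n c root)))
        enter (suc a) a-ok ch = descend a x
          (≤-trans a-ok (≤-reflexive (trans (+-suc _ a) (cong (_+ a) (sym (proj₂ ch)))))) n 0 refl
        split-count : # c j ≤ 1 + (# x 0 + # c (suc j))
        split-count = ≤-trans
          (count-∪ (branches? c j) (Fin._≟ x) (λ u → branches? x 0 u ⊎-dec branches? c (suc j) u)
            (All.universal (λ u br → regroup (branches-split x x≡j br)) W))
          (+-mono-≤ (count-≡ x uniq)
            (count-∪ (λ u → branches? x 0 u ⊎-dec branches? c (suc j) u) (branches? x 0)
                     (branches? c (suc j)) (All.universal (λ _ → id) W)))
          where
          regroup : ∀ {u} {A : Set} {B C : Set} → (u ≡ x × A) ⊎ (A × B) ⊎ C → (u ≡ x) ⊎ (B ⊎ C)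
          regroup (inj₁ (eq , _))        = inj₁ eq
          regroup (inj₂ (inj₁ (_ , b)))  = inj₂ (inj₁ b)
          regroup (inj₂ (inj₂ c))        = inj₂ (inj₂ c)
        step : Dec (ChildOf c x) → Balanced
        step (no ¬ch) = next (≤-trans heavy (*-monoʳ-≤ 4 (count-mono (branches? c j) (branches? c (suc j))
          (λ br → rest (branches-split x x≡j br)) W)))
          where
          rest : ∀ {u} → (u ≡ x × ChildOf c x) ⊎ (ChildOf c x × Branches x 0 u) ⊎ Branches c (suc j) u →
                 Branches c (suc j) u
          rest (inj₁ (_ , ch))        = ⊥-elim (¬ch ch)
          rest (inj₂ (inj₁ (ch , _))) = ⊥-elim (¬ch ch)
          rest (inj₂ (inj₂ br))       = br
        step (yes ch) with ≤-total (# x 0) (# c (suc j))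
        ... | inj₁ x≤c with 4 * # c (suc j) ≤? 3 * m
        ...   | yes light = c , suc j , heavy-half (# c j) (# c (suc j)) heavy
          (≤-trans split-count (s≤s (+-monoˡ-≤ (# c (suc j)) x≤c))) , light
        ...   | no ¬light = next (≰⇒> ¬light)
        step (yes ch) | inj₂ c≤x with 4 * # x 0 ≤? 3 * m
        ...   | yes light = x , 0 , heavy-half (# c j) (# x 0) heavy
          (≤-trans split-count (s≤s (+-monoʳ-≤ (# x 0) c≤x))) , light
        ...   | no ¬light = enter a a-ok ch (≰⇒> ¬light)

    balanced : Balanced
    balanced with 4 * # root 0 ≤? 3 * m
    ... | no ¬light = descend (suc n) root (m≤n+m (suc n) _) n 0 refl (≰⇒> ¬light)
    -- All of W except possibly the root lies in `Branches root 0`, so this set cannot be too small.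
    ... | yes light = root , 0 , quarter m (# root 0) 2≤W m≤ , light
      where
      m≤ : m ≤ 1 + # root 0
      m≤ = ≤-trans (≤-reflexive (cong length (sym (filter-all (_∈ₛ? V) W⊆V))))
        (≤-trans (count-∪ (_∈ₛ? V) (Fin._≟ root) (branches? root 0) (All.universal (λ _ → root-branches) W))
                 (+-monoˡ-≤ _ (count-≡ root uniq)))
      quarter : ∀ m x → 2 ≤ m → m ≤ 1 + x → m ≤ 4 * x
      quarter m zero    2≤m m≤1 = ⊥-elim (<⇒≱ 2≤m m≤1)
      quarter m (suc x) _   m≤  = ≤-trans m≤ (≤-trans (m≤m+n (suc (suc x)) (2 + 3 * x)) (≤-reflexive (slack x)))
        where
        slack : ∀ x → suc (suc x) + (2 + 3 * x) ≡ 4 * suc x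
        slack = solve-∀

  -- Recursive halving of a tree

  -- Code and hubs depend on one vertex only, because a label is written without knowing the
  -- partner. The hubs of s and t coincide at level i because equal codes below i put both vertices
  -- into the part that is split there.
  SeparatedAt : (Fin n → ℕ → Bool) → (Fin n → ℕ → Fin n) → Fin n → Fin n → ℕ → Set
  SeparatedAt code hub s t i =
    (∀ j → j < i → code s j ≡ code t j) × code s i ≢ code t i
    × hub s i ≡ hub t i × dist s t ≡ dist s (hub s i) + dist (hub t i) t

  record Separation (D : ℕ) (W : List (Fin n)) : Set where
    field
      code : Fin n → ℕ → Bool
      hub  : Fin n → ℕ → Fin n
      separated : ∀ {s t} → s ∈ W → t ∈ W → s ≢ t → ∃[ i ] (i < D × SeparatedAt code hub s t i)

  open Separation

  -- The size condition says (3/4)^D · length W < 2. It passes to both parts of a balanced split,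
  -- and at D = 0 it leaves at most one vertex, where there is no pair to separate and the values
  -- are dummies.
  separate : ∀ D {W} → Unique W → All (_∈ₛ V) W → 3 ^ D * length W < 2 * 4 ^ D → Separation D W
  separate D {W} uniq W⊆V size with 2 ≤? length W
  ... | no ¬2≤W = record { code = λ _ _ → false ; hub = λ v _ → v
                         ; separated = λ s∈ t∈ s≢t → ⊥-elim (s≢t (single W (≰⇒> ¬2≤W) s∈ t∈)) }
    where
    single : ∀ W {s t} → length W < 2 → s ∈ W → t ∈ W → s ≡ t
    single (_ ∷ [])    _                (here refl) (here refl) = refl
    single (_ ∷ _ ∷ _) (s≤s (s≤s ()))
  separate zero {W} uniq W⊆V size | yes 2≤W =
    ⊥-elim (<⇒≱ size (≤-trans 2≤W (≤-reflexive (sym (*-identityˡ _)))))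
  separate (suc D) {W} uniq W⊆V size | yes 2≤W with balanced uniq W⊆V 2≤W
  ... | c , j , m≤4x , 4x≤3m = record { code = code′ ; hub = hub′ ; separated = λ s∈ t∈ s≢t → separated′ s∈ t∈ s≢t (B? _) (B? _) }
    where
    B? = branches? c j

    shrink : ∀ x → 4 * x ≤ 3 * length W → 3 ^ D * x < 2 * 4 ^ D
    shrink x 4x≤ = *-cancelˡ-< 4 _ _ (≤-<-trans (≤-reflexive (swap 4 (3 ^ D) x))
      (≤-<-trans (*-monoʳ-≤ (3 ^ D) 4x≤) (subst₂ _<_ (swap′ (3 ^ D) (length W)) (swap 2 4 (4 ^ D)) size)))
      where
      swap : ∀ a b c → a * (b * c) ≡ b * (a * c)
      swap = solve-∀
      swap′ : ∀ a b → 3 * a * b ≡ a * (3 * b)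
      swap′ = solve-∀

    -- The lower bound of a quarter for the branch set becomes the upper bound for its complement.
    rest≤ : 4 * count (∁? B?) W ≤ 3 * length W
    rest≤ = +-cancelˡ-≤ (length W) _ _ (≤-trans (+-monoˡ-≤ _ m≤4x)
      (≤-reflexive (trans (sym (*-distribˡ-+ 4 (count B? W) _)) (cong (4 *_) (count-∁ B? W)))))

    in-sep  : Separation D (filter B? W)
    in-sep  = separate D (Unique.filter⁺ B? uniq) (All.filter⁺ B? W⊆V) (shrink _ 4x≤3m)
    out-sep : Separation D (filter (∁? B?) W)
    out-sep = separate D (Unique.filter⁺ (∁? B?) uniq) (All.filter⁺ (∁? B?) W⊆V) (shrink _ rest≤)

    code′ : Fin n → ℕ → Bool
    code′ v zero    = does (B? v)
    code′ v (suc i) = if does (B? v) then code in-sep v i else code out-sep v i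

    hub′ : Fin n → ℕ → Fin n
    hub′ v zero    = c
    hub′ v (suc i) = if does (B? v) then hub in-sep v i else hub out-sep v i

    via : ∀ {s t} → s ∈ W → t ∈ W → Branches c j s → ¬ Branches c j t → dist s t ≡ dist s c + dist c t
    via s∈ t∈ bs ¬bt = dist-via-exit (branches? c j) branches-exit bs ¬bt
      (dist<n (All.lookup W⊆V s∈) (All.lookup W⊆V t∈))

    true≢false : true ≢ false
    true≢false ()

    in-B : ∀ {v} → Branches c j v → does (B? v) ≡ true
    in-B {v} = dec-true (B? v)
    out-B : ∀ {v} → ¬ Branches c j v → does (B? v) ≡ false
    out-B {v} = dec-false (B? v)

    select : {A : Set} → (Fin n → ℕ → A) → (Fin n → ℕ → A) → Bool → Fin n → ℕ → A
    select f g b v i = if b then f v i else g v i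

    lift : ∀ {s t i b} → does (B? s) ≡ b → does (B? t) ≡ b →
      SeparatedAt (select (code in-sep) (code out-sep) b) (select (hub in-sep) (hub out-sep) b) s t i →
      SeparatedAt code′ hub′ s t (suc i)
    lift {s} {t} {i} {b} es et (agree , differ , hubs , eq) = agree′ ,
      (λ e → differ (trans (sym (code≡ es i)) (trans e (code≡ et i)))) ,
      trans (hub≡ es i) (trans hubs (sym (hub≡ et i))) ,
      subst₂ (λ x y → dist s t ≡ dist s x + dist y t) (sym (hub≡ es i)) (sym (hub≡ et i)) eq
      where
      code≡ : ∀ {v} → does (B? v) ≡ b → ∀ i → code′ v (suc i) ≡ select (code in-sep) (code out-sep) b v i
      code≡ {v} e i = cong (λ b → select (code in-sep) (code out-sep) b v i) e
      hub≡ : ∀ {v} → does (B? v) ≡ b → ∀ i → hub′ v (suc i) ≡ select (hub in-sep) (hub out-sep) b v i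
      hub≡ {v} e i = cong (λ b → select (hub in-sep) (hub out-sep) b v i) e
      agree′ : ∀ j → j < suc i → code′ s j ≡ code′ t j
      agree′ zero    _         = trans es (sym et)
      agree′ (suc j) (s≤s j<i) = trans (code≡ es j) (trans (agree j j<i) (sym (code≡ et j)))

    separated′ : ∀ {s t} → s ∈ W → t ∈ W → s ≢ t → Dec (Branches c j s) → Dec (Branches c j t) →
                 ∃[ i ] (i < suc D × SeparatedAt code′ hub′ s t i)
    separated′ s∈ t∈ s≢t (yes bs) (no ¬bt) = 0 , s≤s z≤n , (λ _ ()) ,
      (λ eq → true≢false (trans (sym (in-B bs)) (trans eq (out-B ¬bt)))) , refl , via s∈ t∈ bs ¬bt
    separated′ {s} {t} s∈ t∈ s≢t (no ¬bs) (yes bt) = 0 , s≤s z≤n , (λ _ ()) ,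
      (λ eq → true≢false (trans (sym (in-B bt)) (trans (sym eq) (out-B ¬bs)))) , refl ,
      trans (dist-sym s t) (trans (via t∈ s∈ bt ¬bs) (trans (+-comm (dist t c) (dist c s))
        (cong₂ _+_ (dist-sym c s) (dist-sym t c))))
    separated′ s∈ t∈ s≢t (yes bs) (yes bt) =
      let i , i<D , rest = separated in-sep (∈-filter⁺ B? s∈ bs) (∈-filter⁺ B? t∈ bt) s≢t
      in suc i , s≤s i<D , lift (in-B bs) (in-B bt) rest
    separated′ s∈ t∈ s≢t (no ¬bs) (no ¬bt) =
      let i , i<D , rest = separated out-sep (∈-filter⁺ (∁? B?) s∈ ¬bs) (∈-filter⁺ (∁? B?) t∈ ¬bt) s≢t
      in suc i , s≤s i<D , lift (out-B ¬bs) (out-B ¬bt) rest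

-- The routing program

branch-< : ∀ {a b l m : ℕ} → a < b → (if a <ᵇ b then l else m) ≡ l
branch-< {l = l} {m} a<b = cong (if_then l else m) (Equivalence.to T-≡ (<⇒<ᵇ a<b))

branch-≮ : ∀ {a b l m : ℕ} → ¬ a < b → (if a <ᵇ b then l else m) ≡ m
branch-≮ {a} {b} a≮b with a <ᵇ b in eq
... | false = refl
... | true  = ⊥-elim (a≮b (<ᵇ⇒< a b (Equivalence.from T-≡ eq)))

update-same : ∀ (f : ℕ → ℕ) i {v} → (f [ i ≔ v ]) i ≡ v
update-same f i {v} = cong (if_then v else f i) (Equivalence.to T-≡ (≡⇒≡ᵇ i i refl))

update-other : ∀ (f : ℕ → ℕ) i {v} j → j ≢ i → (f [ i ≔ v ]) j ≡ f j
update-other f i j j≢i with j ≡ᵇ i in eq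
... | false = refl
... | true  = ⊥-elim (j≢i (≡ᵇ⇒≡ j i (Equivalence.from T-≡ eq)))

module Execution (w : ℕ) (P : Program) (x y : Label w) where

  -- Quantifying over the remaining fuel makes segments composable by addition, and lets
  -- straight-line code be verified by `refl`.
  Steps : ℕ → State → State → Set
  Steps a σ τ = ∀ f → runFrom w P x y (a + f) σ ≡ runFrom w P x y f τ

  Reaches : ℕ → State → State → Set
  Reaches m σ τ = ∃[ a ] a ≤ m × Steps a σ τ

  steps : ∀ a {σ τ} → Steps a σ τ → Reaches a σ τ
  steps a s = a , ≤-refl , s

  infixr 5 _⨾_
  _⨾_ : ∀ {m₁ m₂ σ τ υ} → Reaches m₁ σ τ → Reaches m₂ τ υ → Reaches (m₁ + m₂) σ υ
  _⨾_ {σ = σ} (a , a≤ , s) (b , b≤ , t) = a + b , +-mono-≤ a≤ b≤ ,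
    λ f → trans (cong (λ g → runFrom w P x y g σ) (+-assoc a b f)) (trans (s (b + f)) (t f))

  weaken : ∀ {m₁ m₂ σ τ} → m₁ ≤ m₂ → Reaches m₁ σ τ → Reaches m₂ σ τ
  weaken m≤ (a , a≤ , s) = a , ≤-trans a≤ m≤ , s

  goto : ∀ {pc pc′ reg mem} f → pc ≡ pc′ →
         runFrom w P x y f (state pc reg mem) ≡ runFrom w P x y f (state pc′ reg mem)
  goto f refl = refl

  run-mono : ∀ f {g σ v} → runFrom w P x y f σ ≡ just v → runFrom w P x y (f + g) σ ≡ just v
  run-mono (suc f) {σ = state pc reg mem} eq with head (drop pc P)
  ... | just (const _ _)     = run-mono f eq
  ... | just (arith _ _ _ _) = run-mono f eq
  ... | just (load _ _ _)    = run-mono f eq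
  ... | just (store _ _)     = run-mono f eq
  ... | just (jump< _ _ _)   = run-mono f eq
  ... | just (halt _)        = eq

  -- `Forwards` leaves the number of steps open, so greediness concerns every halting run;
  -- determinism reduces them all to one.
  run-functional : ∀ {f g u v} → run w P x y f ≡ just u → run w P x y g ≡ just v → u ≡ v
  run-functional {f} {g} p q = just-injective (trans (sym (run-mono f {g} p))
    (trans (cong (λ h → run w P x y h) (+-comm f g)) (run-mono g {f} q)))

-- Layout of labels

-- What a vertex stores about one tree. The tables will hold the distances to the hubs, the ports at
-- the vertex towards the hubs, and the ports at the hubs towards the vertex; they are indexed by
-- hash slots rather than levels.
record Entry : Set where
  field
    tag key        : ℕ
    tab₁ tab₂ tab₃ : ℕ → ℕ

open Entry

module Layout (M : ℕ) where

  stride : ℕ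
  stride = 2 + (M + (M + M))

  layout : Entry → List ℕ → List ℕ
  layout e ws = tag e ∷ key e ∷
    applyUpTo (tab₁ e) M ++ applyUpTo (tab₂ e) M ++ applyUpTo (tab₃ e) M ++ ws

  body : List Entry → List ℕ
  body = foldr layout []

  -- The header holds the length of the label, the table size, the length of an entry and the
  -- initial value of the minimum. It also moves all entries away from address 0.
  words : ℕ → List Entry → List ℕ
  words b es = 4 + length (body es) ∷ M ∷ stride ∷ b ∷ body es

  drop-applyUpTo : ∀ (f : ℕ → ℕ) m ws → drop m (applyUpTo f m ++ ws) ≡ ws
  drop-applyUpTo f zero    ws = refl
  drop-applyUpTo f (suc m) ws = drop-applyUpTo (f ∘ suc) m ws

  drop-applyUpTo-< : ∀ (f : ℕ → ℕ) {m h} ws → h < m → ∃[ vs ] drop h (applyUpTo f m ++ ws) ≡ f h ∷ vs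
  drop-applyUpTo-< f {suc m} {zero}  ws _         = _ , refl
  drop-applyUpTo-< f {suc m} {suc h} ws (s≤s h<m) = drop-applyUpTo-< (f ∘ suc) ws h<m

  length-layout : ∀ e ws → length (layout e ws) ≡ stride + length ws
  length-layout e ws = cong (2 +_) (trans (table (tab₁ e) _) (trans (cong (M +_) (trans (table (tab₂ e) _)
    (cong (M +_) (table (tab₃ e) ws)))) (regroup M (length ws))))
    where
    table : ∀ f ws → length (applyUpTo f M ++ ws) ≡ M + length ws
    table f ws = trans (length-++ (applyUpTo f M)) (cong (_+ length ws) (length-applyUpTo f M))
    regroup : ∀ m l → m + (m + (m + l)) ≡ m + (m + m) + l
    regroup = solve-∀

  length-body : ∀ es → length (body es) ≡ length es * stride
  length-body []       = refl
  length-body (e ∷ es) = trans (length-layout e (body es)) (cong (stride +_) (length-body es))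

  module Cells {X : List ℕ} {p e ws} (at : drop p X ≡ layout e ws) where

    at+ : ∀ o → drop (p + o) X ≡ drop o (layout e ws)
    at+ o = trans (sym (drop-drop p o X)) (cong (drop o) at)

    key-cell : ∃[ vs ] drop (p + 1) X ≡ key e ∷ vs
    key-cell = _ , at+ 1

    module _ {h : ℕ} (h<M : h < M) where
      private
        cell : ∀ o {f ws′} → drop (2 + o) (layout e ws) ≡ applyUpTo f M ++ ws′ →
               ∃[ vs ] drop (p + (2 + o + h)) X ≡ f h ∷ vs
        cell o {f} {ws′} eq = let vs , eq′ = drop-applyUpTo-< f ws′ h<M in
          vs , trans (at+ (2 + o + h)) (trans (sym (drop-drop (2 + o) h (layout e ws)))
                 (trans (cong (drop h) eq) eq′))

        reach₂ : drop (2 + M) (layout e ws) ≡ applyUpTo (tab₂ e) M ++ applyUpTo (tab₃ e) M ++ ws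
        reach₂ = drop-applyUpTo (tab₁ e) M _

      cell₁ : ∃[ vs ] drop (p + (2 + h)) X ≡ tab₁ e h ∷ vs
      cell₁ = cell 0 {tab₁ e} refl

      cell₂ : ∃[ vs ] drop (p + (2 + M + h)) X ≡ tab₂ e h ∷ vs
      cell₂ = cell M {tab₂ e} reach₂

      cell₃ : ∃[ vs ] drop (p + (2 + (M + M) + h)) X ≡ tab₃ e h ∷ vs
      cell₃ = cell (M + M) {tab₃ e} (trans (sym (drop-drop (2 + M) M (layout e ws)))
                (trans (cong (drop M) reach₂) (drop-applyUpTo (tab₂ e) M _)))

module Words (w : ℕ) where

  word : ℕ → Word w
  word a = fromℕ< (m%n<n a (2 ^ w) {{m^n≢0 2 w}})

  Fits : List ℕ → Set
  Fits X = All (_< 2 ^ w) X × length X < 2 ^ w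

  read-word : ∀ {X p a vs} → Fits X → drop p X ≡ a ∷ vs → read w (map word X) p ≡ a
  read-word {X} {p} {a} (fits , _) eq = trans
    (cong (maybe toℕ 0 ∘ head) (trans (drop-map p X) (cong (map word) eq)))
    (trans (Fin.toℕ-fromℕ< _) (trunc-< w (All.head (subst (All (_< 2 ^ w)) eq (All.drop⁺ p fits)))))

  drop-∷⇒< : ∀ (X : List ℕ) p {a vs} → drop p X ≡ a ∷ vs → p < length X
  drop-∷⇒< X p eq = ≰⇒> λ len≤p → []≢∷ (trans (sym (drop-all p X len≤p)) eq)
    where
    []≢∷ : ∀ {a : ℕ} {vs : List ℕ} → [] ≢ a ∷ vs
    []≢∷ ()

  add≡ : ∀ {a b u v} → a ≡ u → b ≡ v → u + v < 2 ^ w → ⟦ add ⟧ w a b ≡ u + v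
  add≡ refl refl = trunc-< w

  mod-< : ∀ a {m} → 0 < m → ⟦ mod ⟧ w a m < m
  mod-< a {suc m} _ = m%n<n a (suc m)

-- Registers: 0, 1, 2, 3 hold these constants, 5 and 6 the lengths of the two
-- labels, 7 the table size, 8 the length of an entry, 9 the least distance so
-- far and 17 the port it belongs to.  10 points to the current entry; 12 and
-- 14 are addresses in the two entries of a common tree.  The numbers below are
-- the addresses of jump targets.
router : Program
router =
    const 1 1
  ∷ const 2 2
  ∷ const 3 3
  ∷ load source 5 0
  ∷ load target 6 0
  ∷ load source 7 1
  ∷ load source 8 2
  ∷ load source 9 3
  ∷ arith add 10 3 1
  -- An unconditional jump, since registers 0 and 1 hold 0 and 1.
  ∷ jump< 0 1 13
  -- 10: scratch[tag] ← address of the entry with that tag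
  ∷ load source 11 10
  ∷ store 11 10
  ∷ arith add 10 10 8
  -- 13
  ∷ jump< 10 5 10
  ∷ arith add 10 3 1
  ∷ jump< 0 1 46
  -- 16
  ∷ load target 11 10
  ∷ load scratch 12 11
  -- A zero cell means that the source has no entry for this tree.
  ∷ jump< 0 12 20
  ∷ jump< 0 1 45
  -- 20: the slot of the first level where the two keys differ
  ∷ arith add 12 12 1
  ∷ load source 13 12
  ∷ arith add 14 10 1
  ∷ load target 15 14
  ∷ arith xor 13 13 15
  ∷ arith sub 15 0 13
  ∷ arith and 13 13 15
  ∷ arith mod 13 13 7
  ∷ arith add 12 12 1
  ∷ arith add 12 12 13
  ∷ arith add 14 14 1
  ∷ arith add 14 14 13
  ∷ load source 15 12
  ∷ load target 16 14
  ∷ arith add 16 15 16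
  ∷ jump< 16 9 37
  ∷ jump< 0 1 45
  -- 37: a new best tree
  ∷ arith add 9 16 0
  ∷ jump< 0 15 43
  -- The three tables have equal length, so the same slot lies one table length further in `tab₂`
  -- and two further in `tab₃`.
  ∷ arith add 14 14 7
  ∷ arith add 14 14 7
  ∷ load target 17 14
  ∷ jump< 0 1 45
  -- 43
  ∷ arith add 12 12 7
  ∷ load source 17 12
  -- 45
  ∷ arith add 10 10 8
  ∷ jump< 10 6 16
  ∷ halt 17
  ∷ []

-- Correctness of the program

module Router (w M b : ℕ) (0<M : 0 < M) {N : ℕ} (src tgt : Fin N → Entry)
  (tag-src : ∀ i → tag (src i) ≡ toℕ i) (tag-tgt : ∀ i → tag (tgt i) ≡ toℕ i)
  (Is Js : List (Fin N)) (4≤2^w : 4 ≤ 2 ^ w) where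

  open Layout M
  open Words w

  -- If s is not the hub, its own label knows the port towards it. If s is the hub, at distance 0,
  -- the way on depends on t and is read from the label of t.
  slot score answer : Fin N → ℕ
  slot i = ⟦ mod ⟧ w (⟦ and ⟧ w z (⟦ sub ⟧ w 0 z)) M
    where z = ⟦ xor ⟧ w (key (src i)) (key (tgt i))
  score i = tab₁ (src i) (slot i) + tab₁ (tgt i) (slot i)
  answer i = if 0 <ᵇ tab₁ (src i) (slot i) then tab₂ (src i) (slot i) else tab₃ (tgt i) (slot i)

  module Correct (X Y : List ℕ) (X≡ : X ≡ words b (map src Is)) (Y≡ : Y ≡ words b (map tgt Js))
    (fitsX : Fits X) (fitsY : Fits Y)
    (score< : ∀ i → i ∈ Is → i ∈ Js → score i < 2 ^ w) where

    open Execution w router (map word X) (map word Y)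

    slot<M : ∀ i → slot i < M
    slot<M i = mod-< _ 0<M

    X< : ∀ p {a vs} → drop p X ≡ a ∷ vs → p < 2 ^ w
    X< p eq = <-trans (drop-∷⇒< X p eq) (proj₂ fitsX)

    Y< : ∀ p {a vs} → drop p Y ≡ a ∷ vs → p < 2 ^ w
    Y< p eq = <-trans (drop-∷⇒< Y p eq) (proj₂ fitsY)

    readX : ∀ {p q a vs} → p ≡ q → drop q X ≡ a ∷ vs → read w (map word X) p ≡ a
    readX {p} refl = read-word {X} {p} fitsX

    readY : ∀ {p q a vs} → p ≡ q → drop q Y ≡ a ∷ vs → read w (map word Y) p ≡ a
    readY {p} refl = read-word {Y} {p} fitsY

    -- An unfolding product, so that it is inherited definitionally by register
    -- files that agree on the registers mentioned.
    Inv : (ℕ → ℕ) → Set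
    Inv reg = reg 0 ≡ 0 × reg 1 ≡ 1 × reg 3 ≡ 3 × reg 5 ≡ length X × reg 6 ≡ length Y
            × reg 7 ≡ M × reg 8 ≡ stride

    Points : ℕ → Fin N → Set
    Points p i = 0 < p × ∃[ ws ] drop p X ≡ layout (src i) ws

    next-entry : ∀ (Z : List ℕ) {p e ws} → drop p Z ≡ layout e ws →
                 drop (p + stride) Z ≡ ws × p + stride ≤ length Z
    next-entry Z {p} {e} {ws} at = drop≡ , subst (p + stride ≤_) (sym (begin-equality
        length Z                      ≡⟨ m+[n∸m]≡n {p} {length Z} (<⇒≤ (drop-∷⇒< Z p at)) ⟨
        p + (length Z ∸ p)            ≡⟨ cong (p +_) (trans (sym (length-drop p Z)) (trans (cong length at) (length-layout e ws))) ⟩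
        p + (stride + length ws)      ≡⟨ +-assoc p stride _ ⟨
        p + stride + length ws        ∎)) (m≤m+n (p + stride) (length ws))
      where
      open ≤-Reasoning
      drop≡ : drop (p + stride) Z ≡ ws
      drop≡ = trans (sym (drop-drop p stride Z)) (trans (cong (drop stride) at)
        (trans (sym (drop-drop M (M + M) _)) (trans (cong (drop (M + M)) (drop-applyUpTo (tab₁ e) M _))
          (trans (sym (drop-drop M M _)) (trans (cong (drop M) (drop-applyUpTo (tab₂ e) M _))
            (drop-applyUpTo (tab₃ e) M ws))))))

    at-end : ∀ (Z : List ℕ) {p} → drop p Z ≡ [] → ¬ p < length Z
    at-end Z {p} eq = ≤⇒≯ (m∸n≡0⇒m≤n (trans (sym (length-drop p Z)) (cong length eq)))

    prologue : ∃[ reg ] (Reaches 10 (state 0 (λ _ → 0) (λ _ → 0)) (state 13 reg (λ _ → 0))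
                         × Inv reg × reg 9 ≡ b × reg 10 ≡ 4)
    prologue = _ ,
      steps 10 (λ f → goto f (branch-< (subst (0 <_) (sym one) (s≤s z≤n)))) ,
      (refl , one , three , readX {q = 0} refl (end (map src Is) X≡) , readY {q = 0} refl (end (map tgt Js) Y≡) ,
       readX {q = 1} one (cong (drop 1) X≡) , readX {q = 2} two (cong (drop 2) X≡)) ,
      readX {q = 3} three (cong (drop 3) X≡) , four
      where
      end : ∀ {Z} es → Z ≡ words b es → drop 0 Z ≡ length Z ∷ drop 1 Z
      end _ refl = refl
      4+≤ : ∀ {Z} es → Z ≡ words b es → 4 ≤ length Z
      4+≤ _ refl = m≤m+n 4 _
      small : ∀ {a} → a < 4 → trunc w a ≡ a
      small a<4 = trunc-< w (<-≤-trans a<4 4≤2^w)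
      one   = small {1} (s≤s (s≤s z≤n))
      two   = small {2} (s≤s (s≤s (s≤s z≤n)))
      three = small {3} (s≤s (s≤s (s≤s (s≤s z≤n))))
      four : ⟦ add ⟧ w (trunc w 3) (trunc w 1) ≡ 4
      four = add≡ three one (≤-<-trans (4+≤ (map src Is) X≡) (proj₂ fitsX))

    -- Direct addressing by tags makes the later test for a common tree a single load. The second
    -- alternative, an untouched cell, becomes the value 0 when the loop starts from empty memory.
    fill : ∀ Rs {reg mem p} → Inv reg → reg 10 ≡ p → 0 < p → drop p X ≡ body (map src Rs) →
           ∃[ reg′ ] ∃[ mem′ ] (Reaches (length Rs * 4 + 1) (state 13 reg mem) (state 14 reg′ mem′)
             × Inv reg′ × reg′ 9 ≡ reg 9
             × (∀ i → (i ∈ Rs × Points (mem′ (toℕ i)) i) ⊎ (i ∉ Rs × mem′ (toℕ i) ≡ mem (toℕ i))))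
    fill [] {reg} inv@(_ , _ , _ , r₅ , _) r₁₀ 0<p at = _ , _ ,
      steps 1 (λ f → goto f (branch-≮ (λ p< → at-end X at (subst₂ _<_ r₁₀ r₅ p<)))) ,
      inv , refl , λ i → inj₂ ((λ ()) , refl)
    fill (r ∷ Rs) {reg} {mem} {p} inv@(_ , _ , _ , r₅ , _ , _ , r₈) r₁₀ 0<p at
      with next-entry X {e = src r} at
    ... | at′ , p+≤ with fill Rs
            {(reg [ 11 ≔ read w (map word X) (reg 10) ]) [ 10 ≔ ⟦ add ⟧ w (reg 10) (reg 8) ]}
            {mem [ read w (map word X) (reg 10) ≔ reg 10 ]}
            inv (add≡ r₁₀ r₈ (≤-<-trans p+≤ (proj₂ fitsX))) (≤-trans 0<p (m≤m+n p stride)) at′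
    ...   | reg′ , mem′ , reach , inv′ , r₉ , filled = reg′ , mem′ ,
      steps 4 (λ f → goto (3 + f) (branch-< (subst₂ _<_ (sym r₁₀) (sym r₅) (drop-∷⇒< X p at)))) ⨾ reach ,
      inv′ , r₉ , filled′
      where
      tag≡ : read w (map word X) (reg 10) ≡ toℕ r
      tag≡ = trans (readX r₁₀ at) (tag-src r)
      filled′ : ∀ i → (i ∈ r ∷ Rs × Points (mem′ (toℕ i)) i) ⊎ (i ∉ r ∷ Rs × mem′ (toℕ i) ≡ mem (toℕ i))
      filled′ i with filled i
      ... | inj₁ (i∈ , pt) = inj₁ (there i∈ , pt)
      ... | inj₂ (i∉ , eq) with i Fin.≟ r
      ...   | yes refl = inj₁ (here refl , subst (λ q → Points q i)
                (sym (trans eq (trans (cong (λ t → (mem [ t ≔ reg 10 ]) (toℕ i)) tag≡)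
                  (trans (update-same mem (toℕ i)) r₁₀)))) (0<p , _ , at))
      ...   | no i≢r = inj₂ ((λ { (here eq′) → i≢r eq′ ; (there i∈) → i∉ i∈ }) ,
                trans eq (update-other mem _ (toℕ i) (λ eq′ → i≢r (Fin.toℕ-injective (trans eq′ tag≡)))))

    MemInv : (ℕ → ℕ) → Set
    MemInv mem = ∀ i → (i ∈ Is × Points (mem (toℕ i)) i) ⊎ (i ∉ Is × mem (toℕ i) ≡ 0)

    Update : Fin N → (reg reg′ : ℕ → ℕ) → Set
    Update i reg reg′ =
      (reg′ 9 ≡ reg 9 × reg′ 17 ≡ reg 17 × (i ∈ Is → reg 9 ≤ score i))
      ⊎ (i ∈ Is × score i < reg 9 × reg′ 9 ≡ score i × reg′ 17 ≡ answer i)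

    compare : ∀ {i q mem reg p ws} → i ∈ Is → i ∈ Js → Inv reg → reg 10 ≡ p → drop p Y ≡ layout (tgt i) ws →
              reg 12 ≡ q → Points q i →
              ∃[ reg′ ] (Reaches 23 (state 20 reg mem) (state 45 reg′ mem)
                × Inv reg′ × reg′ 10 ≡ p × Update i reg reg′)
    compare {i} {q} {mem} {reg} {p} i∈ i∈Js inv@(r₀ , r₁ , _ , _ , _ , r₇ , _) r₁₀ at r₁₂ (_ , _ , ats)
      = conclude
      where
      module S = Cells {X} {q} {src i} ats
      module T = Cells {Y} {p} {tgt i} at
      h = slot i
      h<M = slot<M i

      s₁ = add≡ r₁₂ r₁ (X< _ (proj₂ S.key-cell))
      t₁ = add≡ r₁₀ r₁ (Y< _ (proj₂ T.key-cell))
      key-s = readX s₁ (proj₂ S.key-cell)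
      key-t = readY t₁ (proj₂ T.key-cell)

      slot≡ : ∀ {a c m z} → a ≡ key (src i) → c ≡ key (tgt i) → m ≡ M → z ≡ 0 →
              ⟦ mod ⟧ w (⟦ and ⟧ w (⟦ xor ⟧ w a c) (⟦ sub ⟧ w z (⟦ xor ⟧ w a c))) m ≡ h
      slot≡ refl refl refl refl = refl

      add₃ : ∀ {a b c u} → a ≡ u + 1 → b ≡ 1 → c ≡ h → u + (2 + h) < 2 ^ w →
             ⟦ add ⟧ w (⟦ add ⟧ w a b) c ≡ u + (2 + h)
      add₃ {u = u} ea eb ec u< = trans (add≡ (add≡ ea eb
        (≤-<-trans (≤-trans (m≤m+n (u + 1 + 1) h) (≤-reflexive (assoc u h))) u<)) ec
          (≤-<-trans (≤-reflexive (assoc u h)) u<)) (assoc u h)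
        where
        assoc : ∀ u h → u + 1 + 1 + h ≡ u + (2 + h)
        assoc = solve-∀

      keyed : ∃[ reg′ ] (Reaches 4 (state 20 reg mem) (state 24 reg′ mem)
        × Inv reg′ × reg′ 9 ≡ reg 9 × reg′ 17 ≡ reg 17 × reg′ 10 ≡ p
        × reg′ 12 ≡ q + 1 × reg′ 14 ≡ p + 1
        × reg′ 13 ≡ key (src i) × reg′ 15 ≡ key (tgt i))
      keyed = _ , steps 4 (λ f → refl) , inv , refl , refl , r₁₀ , s₁ , t₁ , key-s , key-t

      slotted : ∀ {reg} → Inv reg → reg 13 ≡ key (src i) → reg 15 ≡ key (tgt i) →
        ∃[ reg′ ] (Reaches 4 (state 24 reg mem) (state 28 reg′ mem)
        × Inv reg′ × reg′ 9 ≡ reg 9 × reg′ 17 ≡ reg 17 × reg′ 10 ≡ reg 10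
        × reg′ 12 ≡ reg 12 × reg′ 14 ≡ reg 14 × reg′ 13 ≡ h)
      slotted inv@(r₀ , _ , _ , _ , _ , r₇ , _) r₁₃ r₁₅ = _ , steps 4 (λ f → refl) , inv ,
        refl , refl , refl , refl , refl , slot≡ r₁₃ r₁₅ r₇ r₀

      summed : ∀ {reg} → Inv reg → reg 12 ≡ q + 1 → reg 14 ≡ p + 1 → reg 13 ≡ h →
        ∃[ reg′ ] (Reaches 7 (state 28 reg mem) (state 35 reg′ mem)
        × Inv reg′ × reg′ 9 ≡ reg 9 × reg′ 17 ≡ reg 17 × reg′ 10 ≡ reg 10
        × reg′ 12 ≡ q + (2 + h) × reg′ 14 ≡ p + (2 + h)
        × reg′ 15 ≡ tab₁ (src i) h × reg′ 16 ≡ score i)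
      summed inv@(_ , r₁ , _) r₁₂ r₁₄ r₁₃ = _ , steps 7 (λ f → refl) , inv , refl , refl , refl ,
        s₂ , t₂ , ds , add≡ ds dt (score< i i∈ i∈Js)
        where
        s₂ = add₃ r₁₂ r₁ r₁₃ (X< _ (proj₂ (S.cell₁ h<M)))
        t₂ = add₃ r₁₄ r₁ r₁₃ (Y< _ (proj₂ (T.cell₁ h<M)))
        ds = readX s₂ (proj₂ (S.cell₁ h<M))
        dt = readY t₂ (proj₂ (T.cell₁ h<M))

      scored : ∃[ reg′ ] (Reaches 15 (state 20 reg mem) (state 35 reg′ mem)
        × Inv reg′ × reg′ 9 ≡ reg 9 × reg′ 17 ≡ reg 17 × reg′ 10 ≡ p
        × reg′ 12 ≡ q + (2 + h) × reg′ 14 ≡ p + (2 + h)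
        × reg′ 15 ≡ tab₁ (src i) h × reg′ 16 ≡ score i)
      scored with keyed
      ... | reg₁ , reach₁ , inv₁ , b₁ , c₁ , d₁ , q₁ , p₁ , k₁ , k₂ with slotted {reg₁} inv₁ k₁ k₂
      ...   | reg₂ , reach₂ , inv₂ , b₂ , c₂ , d₂ , q₂ , p₂ , h₂
              with summed {reg₂} inv₂ (trans q₂ q₁) (trans p₂ p₁) h₂
      ...     | reg₃ , reach₃ , inv₃ , b₃ , c₃ , d₃ , rest = reg₃ , reach₁ ⨾ reach₂ ⨾ reach₃ , inv₃ ,
                trans b₃ (trans b₂ b₁) , trans c₃ (trans c₂ c₁) , trans d₃ (trans d₂ d₁) , rest

      to-table₂ : ∀ u → u + (2 + h) + M ≡ u + (2 + M + h)
      to-table₂ u = shuffle u h M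
        where
        shuffle : ∀ u h m → u + (2 + h) + m ≡ u + (2 + m + h)
        shuffle = solve-∀

      to-table₃ : ∀ u → u + (2 + h) + M + M ≡ u + (2 + (M + M) + h)
      to-table₃ u = shuffle u h M
        where
        shuffle : ∀ u h m → u + (2 + h) + m + m ≡ u + (2 + (m + m) + h)
        shuffle = solve-∀

      Improved : (ℕ → ℕ) → Set
      Improved reg = ∃[ reg′ ] (Reaches 6 (state 37 reg mem) (state 45 reg′ mem)
          × Inv reg′ × reg′ 10 ≡ p × reg′ 9 ≡ score i × reg′ 17 ≡ answer i)

      improve : ∀ {reg} → Inv reg → reg 10 ≡ p → reg 12 ≡ q + (2 + h) → reg 14 ≡ p + (2 + h) →
        reg 15 ≡ tab₁ (src i) h → reg 16 ≡ score i → Dec (0 < tab₁ (src i) h) → Improved reg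
      improve {reg} inv@(r₀ , r₁ , _ , _ , _ , r₇ , _) r₁₀ r₁₂ r₁₄ r₁₅ r₁₆ = λ
        { (yes 0<d) → _ ,
            (steps 2 (λ f → goto f (branch-< (subst₂ _<_ (sym r₀) (sym r₁₅) 0<d))) ⨾
             weaken (m≤m+n 2 2) (steps 2 (λ f → refl))) ,
            inv , r₁₀ , best , trans (readX (trans (add≡ r₁₂ r₇ bound₂) (to-table₂ q)) (proj₂ (S.cell₂ h<M)))
              (sym (branch-< 0<d))
        ; (no ¬0<d) → _ ,
            (steps 2 (λ f → goto f (branch-≮ (λ lt → ¬0<d (subst₂ _<_ r₀ r₁₅ lt)))) ⨾
             steps 4 (λ f → goto f (branch-< (subst₂ _<_ (sym r₀) (sym r₁) (s≤s z≤n))))) ,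
            inv , r₁₀ , best ,
            trans (readY (trans (add≡ (add≡ r₁₄ r₇ (≤-<-trans (m≤m+n _ M) bound₃)) r₇ bound₃) (to-table₃ p))
              (proj₂ (T.cell₃ h<M))) (sym (branch-≮ ¬0<d)) }
        where
        best : ⟦ add ⟧ w (reg 16) (reg 0) ≡ score i
        best = trans (add≡ r₁₆ r₀ (subst (_< 2 ^ w) (sym (+-identityʳ (score i))) (score< i i∈ i∈Js)))
                     (+-identityʳ (score i))
        bound₂ : q + (2 + h) + M < 2 ^ w
        bound₂ = subst (_< 2 ^ w) (sym (to-table₂ q)) (X< _ (proj₂ (S.cell₂ h<M)))
        bound₃ : p + (2 + h) + M + M < 2 ^ w
        bound₃ = subst (_< 2 ^ w) (sym (to-table₃ p)) (Y< _ (proj₂ (T.cell₃ h<M)))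

      conclude : ∃[ reg′ ] (Reaches 23 (state 20 reg mem) (state 45 reg′ mem)
                  × Inv reg′ × reg′ 10 ≡ p × Update i reg reg′)
      conclude = let reg₁ , reach₁ , inv₁@(z , o , _) , r₉ , r₁₇ , r₁₀′ , r₁₂′ , r₁₄′ , r₁₅′ , r₁₆′ = scored in
        decide reg₁ reach₁ inv₁ r₉ r₁₇ r₁₀′ r₁₆′
          (improve {reg₁} inv₁ r₁₀′ r₁₂′ r₁₄′ r₁₅′ r₁₆′ (0 <? tab₁ (src i) h)) (score i <? reg 9)
        where
        decide : ∀ reg₁ → Reaches 15 (state 20 reg mem) (state 35 reg₁ mem) → Inv reg₁ → reg₁ 9 ≡ reg 9 →
          reg₁ 17 ≡ reg 17 → reg₁ 10 ≡ p → reg₁ 16 ≡ score i → Improved reg₁ → Dec (score i < reg 9) →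
          ∃[ reg′ ] (Reaches 23 (state 20 reg mem) (state 45 reg′ mem)
            × Inv reg′ × reg′ 10 ≡ p × Update i reg reg′)
        decide reg₁ reach₁ _ r₉ _ _ r₁₆ (reg₂ , reach₂ , inv₂ , r₁₀ , r₉′ , r₁₇) (yes better) = reg₂ ,
          weaken (n≤1+n 22) (reach₁ ⨾
            steps 1 (λ f → goto f (branch-< (subst₂ _<_ (sym r₁₆) (sym r₉) better))) ⨾ reach₂) ,
          inv₂ , r₁₀ , inj₂ (i∈ , better , r₉′ , r₁₇)
        decide reg₁ reach₁ inv₁@(z , o , _) r₉ r₁₇ r₁₀ r₁₆ _ (no ¬better) = reg₁ ,
          weaken (m≤m+n 17 6) (reach₁ ⨾
            steps 1 (λ f → goto f (branch-≮ (λ lt → ¬better (subst₂ _<_ r₁₆ r₉ lt)))) ⨾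
            steps 1 (λ f → goto f (branch-< (subst₂ _<_ (sym z) (sym o) (s≤s z≤n))))) ,
          inv₁ , r₁₀ , inj₁ (r₉ , r₁₇ , λ _ → ≮⇒≥ ¬better)

    visit : ∀ {i mem reg p ws} → MemInv mem → i ∈ Js → Inv reg → reg 10 ≡ p → drop p Y ≡ layout (tgt i) ws →
            ∃[ reg′ ] (Reaches 27 (state 16 reg mem) (state 46 reg′ mem)
              × Inv reg′ × reg′ 10 ≡ p + stride × Update i reg reg′)
    visit {i} {mem} {reg} {p} meminv i∈Js inv@(r₀ , r₁ , _) r₁₀ at = dispatch (meminv i)
      where
      tag≡ : read w (map word Y) (reg 10) ≡ toℕ i
      tag≡ = trans (readY r₁₀ at) (tag-tgt i)

      advance : ∀ {reg} → Inv reg → reg 10 ≡ p → ∃[ reg′ ] (Reaches 1 (state 45 reg mem) (state 46 reg′ mem)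
        × Inv reg′ × reg′ 10 ≡ p + stride × reg′ 9 ≡ reg 9 × reg′ 17 ≡ reg 17)
      advance inv@(_ , _ , _ , _ , _ , _ , r₈) r₁₀ = _ , steps 1 (λ f → refl) , inv ,
        add≡ r₁₀ r₈ (≤-<-trans (proj₂ (next-entry Y {p} {tgt i} at)) (proj₂ fitsY)) , refl , refl

      fetched : ∃[ reg′ ] (Reaches 2 (state 16 reg mem) (state 18 reg′ mem) × Inv reg′ × reg′ 10 ≡ p
        × reg′ 9 ≡ reg 9 × reg′ 17 ≡ reg 17 × reg′ 12 ≡ mem (toℕ i))
      fetched = _ , steps 2 (λ f → refl) , inv , r₁₀ , refl , refl , cong mem tag≡

      transport : ∀ {reg₁ reg₂ reg₃} → reg₁ 9 ≡ reg 9 → reg₁ 17 ≡ reg 17 →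
        reg₃ 9 ≡ reg₂ 9 → reg₃ 17 ≡ reg₂ 17 → Update i reg₁ reg₂ → Update i reg reg₃
      transport a b c d (inj₁ (e , f , g)) =
        inj₁ (trans c (trans e a) , trans d (trans f b) , λ i∈ → ≤-trans (≤-reflexive (sym a)) (g i∈))
      transport a b c d (inj₂ (e , f , g , h)) =
        inj₂ (e , subst (score i <_) a f , trans c g , trans d h)

      dispatch : (i ∈ Is × Points (mem (toℕ i)) i) ⊎ (i ∉ Is × mem (toℕ i) ≡ 0) →
        ∃[ reg′ ] (Reaches 27 (state 16 reg mem) (state 46 reg′ mem)
              × Inv reg′ × reg′ 10 ≡ p + stride × Update i reg reg′)
      dispatch (inj₁ (i∈ , pts)) =
        let reg₁ , reach₁ , inv₁ , a₁ , b₁ , c₁ , d₁ = fetched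
            reg₂ , reach₂ , inv₂ , a₂ , update = compare {reg = reg₁} i∈ i∈Js inv₁ a₁ at d₁ pts
            reg₃ , reach₃ , inv₃ , a₃ , b₃ , c₃ = advance {reg₂} inv₂ a₂
        in reg₃ , reach₁ ⨾ steps 1 (λ f → goto f (branch-< (subst₂ _<_ (sym (proj₁ inv₁)) (sym d₁) (proj₁ pts))))
                  ⨾ reach₂ ⨾ reach₃ ,
           inv₃ , a₃ , transport {reg₁} {reg₂} {reg₃} b₁ c₁ b₃ c₃ update
      dispatch (inj₂ (i∉ , empty)) =
        let reg₁ , reach₁ , inv₁ , a₁ , b₁ , c₁ , d₁ = fetched
            reg₂ , reach₂ , inv₂ , a₂ , b₂ , c₂ = advance {reg₁} inv₁ a₁
        in reg₂ , weaken (m≤m+n 5 22) (reach₁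
             ⨾ steps 1 (λ f → goto f (branch-≮ (λ lt → n≮0 (subst (_ <_) (trans d₁ empty) lt))))
             ⨾ steps 1 (λ f → goto f (branch-< (subst₂ _<_ (sym (proj₁ inv₁)) (sym (proj₁ (proj₂ inv₁))) (s≤s z≤n))))
             ⨾ reach₂) ,
           inv₂ , a₂ , inj₁ (trans b₂ b₁ , trans c₂ c₁ , λ i∈ → ⊥-elim (i∉ i∈))

    -- As long as no common tree has improved on the initial bound b, register 17 is meaningless; a
    -- common tree with score below b excludes this at the end.
    Recorded : (ℕ → ℕ) → Set
    Recorded reg = reg 9 ≡ b ⊎ ∃[ i ] (i ∈ Is × i ∈ Js × reg 9 ≡ score i × reg 17 ≡ answer i)

    scan : ∀ Rs {reg mem p} → All (_∈ Js) Rs → MemInv mem → Inv reg → reg 10 ≡ p → drop p Y ≡ body (map tgt Rs) →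
      Recorded reg →
      ∃[ reg′ ] (Reaches (length Rs * 28 + 1) (state 46 reg mem) (state 47 reg′ mem)
        × reg′ 9 ≤ reg 9 × All (λ i → i ∈ Is → reg′ 9 ≤ score i) Rs
        × Recorded reg′)
    scan [] {reg} _ _ (_ , _ , _ , _ , r₆ , _) r₁₀ at best = reg ,
      steps 1 (λ f → goto f (branch-≮ (λ p< → at-end Y at (subst₂ _<_ r₁₀ r₆ p<)))) , ≤-refl , [] , best
    scan (r ∷ Rs) {reg} {mem} {p} (r∈ ∷ Rs⊆) meminv inv@(_ , _ , _ , _ , r₆ , _) r₁₀ at best =
      let reg₁ , reach₁ , inv₁ , a₁ , update = visit {r} {mem} {reg} meminv r∈ inv r₁₀ at
          reg₂ , reach₂ , le₂ , all₂ , best₂ = scan Rs {reg₁} Rs⊆ meminv inv₁ a₁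
            (proj₁ (next-entry Y {p} {tgt r} at)) (carry reg₁ update)
      in reg₂ , steps 1 (λ f → goto f (branch-< (subst₂ _<_ (sym r₁₀) (sym r₆) (drop-∷⇒< Y p at))))
                ⨾ reach₁ ⨾ reach₂ ,
         ≤-trans le₂ (decrease reg₁ update) ,
         (λ r∈Is → ≤-trans le₂ (beats reg₁ update r∈Is)) ∷ all₂ , best₂
      where
      carry : ∀ reg₁ → Update r reg reg₁ → Recorded reg₁
      carry reg₁ (inj₂ (r∈Is , _ , e , f)) = inj₂ (r , r∈Is , r∈ , e , f)
      carry reg₁ (inj₁ (e , f , _)) = [ (λ eq → inj₁ (trans e eq))
        , (λ (i , i∈ , i∈Js , g , h) → inj₂ (i , i∈ , i∈Js , trans e g , trans f h)) ]′ best
      decrease : ∀ reg₁ → Update r reg reg₁ → reg₁ 9 ≤ reg 9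
      decrease reg₁ (inj₁ (e , _))           = ≤-reflexive e
      decrease reg₁ (inj₂ (_ , lt , e , _))  = ≤-trans (≤-reflexive e) (<⇒≤ lt)
      beats : ∀ reg₁ → Update r reg reg₁ → r ∈ Is → reg₁ 9 ≤ score r
      beats reg₁ (inj₁ (e , _ , g)) r∈Is     = ≤-trans (≤-reflexive e) (g r∈Is)
      beats reg₁ (inj₂ (_ , _ , e , _)) _    = ≤-reflexive e

    budget : ℕ
    budget = 10 + ((length Is * 4 + 1) + (2 + (length Js * 28 + 1)))

    rewind : ∀ {reg mem} → Inv reg → ∃[ reg′ ] (Reaches 2 (state 14 reg mem) (state 46 reg′ mem)
      × Inv reg′ × reg′ 10 ≡ 4 × reg′ 9 ≡ reg 9)
    rewind inv@(r₀ , r₁ , r₃ , _) = _ ,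
      steps 2 (λ f → goto f (branch-< (subst₂ _<_ (sym r₀) (sym r₁) (s≤s z≤n)))) , inv ,
      add≡ r₃ r₁ (≤-<-trans (4≤words Y≡) (proj₂ fitsY)) , refl
      where
      4≤words : ∀ {Z} → Z ≡ words b (map tgt Js) → 4 ≤ length Z
      4≤words refl = m≤m+n 4 _

    finds-best : ∀ {j F} → j ∈ Is → j ∈ Js → score j < b → budget < F →
      ∃[ i ] (i ∈ Is × i ∈ Js × run w router (map word X) (map word Y) F ≡ just (answer i)
              × (∀ j → j ∈ Is → j ∈ Js → score i ≤ score j))
    finds-best {j} {F} j∈ j∈Js j<b F> with prologue
    ... | reg₁ , reach₁ , inv₁ , b₁ , p₁
        with fill Is {reg₁} inv₁ p₁ (s≤s z≤n) (cong (drop 4) X≡)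
    ...   | reg₂ , mem , reach₂ , inv₂ , b₂ , filled
          with rewind {reg₂} inv₂
    ...     | reg₃ , reach₃ , inv₃ , p₃ , b₃
            with scan Js {reg₃} (All.tabulate (λ i∈ → i∈)) filled inv₃ p₃ (cong (drop 4) Y≡)
                   (inj₁ (trans b₃ (trans b₂ b₁)))
    ...       | reg₄ , reach₄ , _ , least₄ , best₄ = conclude best₄
      where
      finish : ∃[ a ] a ≤ budget × Steps a (state 0 (λ _ → 0) (λ _ → 0)) (state 47 reg₄ mem)
      finish = reach₁ ⨾ reach₂ ⨾ reach₃ ⨾ reach₄
      output : run w router (map word X) (map word Y) F ≡ just (reg₄ 17)
      output with finish
      ... | a , a≤ , s with m≤n⇒∃[o]m+o≡n (≤-<-trans a≤ F>)
      ...   | o , refl = trans (cong (λ f → run w router (map word X) (map word Y) f) (sym (+-suc a o))) (s (suc o))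
      conclude : Recorded reg₄ → ∃[ i ] (i ∈ Is × i ∈ Js × run w router (map word X) (map word Y) F ≡ just (answer i)
              × (∀ j → j ∈ Is → j ∈ Js → score i ≤ score j))
      -- Here register 9 would still hold b, although the scan left it at most the score of j.
      conclude (inj₁ none) = ⊥-elim (<⇒≱ j<b (≤-trans (≤-reflexive (sym none)) (All.lookup least₄ j∈Js j∈)))
      conclude (inj₂ (i , i∈ , i∈Js , e , f)) = i , i∈ , i∈Js , trans output (cong just f) ,
        λ j j∈ j∈Js → ≤-trans (≤-reflexive (sym e)) (All.lookup least₄ j∈Js j∈)

-- The routing scheme of a tree cover

fromℕ-mono-≤ : ∀ {a b} → a ≤ b → fromℕ a ℚ.≤ fromℕ b
fromℕ-mono-≤ {a} {b} a≤b = ℚ.toℚᵘ-cancel-≤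
  (ℚᵘ.≤-respˡ-≃ (ℚᵘ.≃-sym (ℚ.toℚᵘ-fromℚᵘ (ℚᵘ.mkℚᵘ (ℤ.+ a) 0)))
    (ℚᵘ.≤-respʳ-≃ (ℚᵘ.≃-sym (ℚ.toℚᵘ-fromℚᵘ (ℚᵘ.mkℚᵘ (ℤ.+ b) 0)))
      (ℚᵘ.*≤* (ℤ.*-monoʳ-≤-nonNeg (ℤ.+ 1) (ℤ.+≤+ a≤b)))))

fromℕ-mono-< : ∀ {a b} → a < b → fromℕ a ℚ.< fromℕ b
fromℕ-mono-< {a} {b} a<b = ℚ.toℚᵘ-cancel-<
  (ℚᵘ.<-respˡ-≃ (ℚᵘ.≃-sym (ℚ.toℚᵘ-fromℚᵘ (ℚᵘ.mkℚᵘ (ℤ.+ a) 0)))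
    (ℚᵘ.<-respʳ-≃ (ℚᵘ.≃-sym (ℚ.toℚᵘ-fromℚᵘ (ℚᵘ.mkℚᵘ (ℤ.+ b) 0)))
      (ℚᵘ.*<* (ℤ.*-monoʳ-<-pos (ℤ.+ 1) (ℤ.+<+ a<b)))))

WithinStretch-≤ : ∀ c ℓ {a b m} → a ≤ b → WithinStretch c ℓ b m → WithinStretch c ℓ a m
WithinStretch-≤ c ℓ a≤b (inj₁ p) = inj₁ λ u → ℚ.≤-trans (fromℕ-mono-≤ a≤b) (p u)
WithinStretch-≤ c ℓ a≤b (inj₂ p) = inj₂ λ u → ℚ.≤-trans (fromℕ-mono-≤ a≤b) (p u)

fromℚ-mono-< : ∀ {p q} → p ℚ.< q → fromℚ p <ᵣ fromℚ q
fromℚ-mono-< p<q = ℚ.<-dense p<q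

module _ {n : ℕ} (δ : Fin n → Fin n → ℕ) (δ-refl : ∀ s → δ s s ≡ 0)
         (δ-definite : ∀ s t → δ s t ≡ 0 → s ≡ t) (δ-sym : ∀ s t → δ s t ≡ δ t s) where

  ℕ-semiMetric : IsSemiMetric (λ s t → fromℚ (fromℕ (δ s t)))
  ℕ-semiMetric = record
    { nonNegative = λ s t q<0 → ℚ.<-≤-trans q<0 (fromℕ-mono-≤ (z≤n {δ s t}))
    ; definite    = λ s t → mk⇔ (λ (δ≤0 , _) → δ-definite s t (zero-below (δ s t) δ≤0))
        (λ { refl → subst (λ m → fromℚ (fromℕ m) ≃ᵣ 0ᵣ) (sym (δ-refl s)) ((λ q< → q<) , (λ q< → q<)) })
    ; symmetric   = λ s t → subst (λ m → fromℚ (fromℕ (δ s t)) ≃ᵣ fromℚ (fromℕ m)) (δ-sym s t)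
        ((λ q< → q<) , (λ q< → q<)) }
    where
    zero-below : ∀ m → fromℚ (fromℕ m) ≤ᵣ 0ᵣ → m ≡ 0
    zero-below zero    _   = refl
    zero-below (suc m) m≤0 = ⊥-elim (ℚ.<-irrefl refl (m≤0 (fromℕ-mono-< (s≤s (z≤n {m})))))

distance-unique : ∀ {n} {E} {s t : Fin n} {a b} → Distance E s t a → Distance E s t b → a ≡ b
distance-unique record { attained = p , refl ; shortest = p-min }
                record { attained = q , refl ; shortest = q-min } = ≤-antisym (p-min q) (q-min p)

-- Indices serve as tags. A family may repeat a tree, and sparseness counts the indices, which is
-- what the length of a label depends on.
record IndexedCover {n : ℕ} (G : Graph n) (c ℓ : ℝ) (K : ℕ) : Set₁ where
  open Graph G using (_~_)
  open Subgraph
  field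
    size   : ℕ
    tree   : Fin size → Subgraph G
    isTree : ∀ i → IsTree (tree i)
    covers : ∀ s t → ∃[ i ] (s ∈ₛ V (tree i) × t ∈ₛ V (tree i) ×
               ∃[ a ] ∃[ m ] Distance (Edge (tree i)) s t a × Distance _~_ s t m × WithinStretch c ℓ a m)

  trees : Fin n → List (Fin size)
  trees v = filter (λ i → v ∈ₛ? V (tree i)) (allFin size)

  field
    sparse : ∀ v → length (trees v) ≤ K

mod≡% : ∀ w a m .{{_ : NonZero m}} → ⟦ mod ⟧ w a m ≡ a % m
mod≡% w a (suc m) = refl

module Construction {n : ℕ} {G : Graph n} {c ℓ : ℝ} {K : ℕ} (cover : IndexedCover G c ℓ K) (w e : ℕ) where

  open Graph G using (_~_)
  open Subgraph
  open IndexedCover cover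

  -- The number of levels is itself a power of 3, so that `2^-mod-injective` covers exactly the
  -- levels, at the price of tables with 3D slots.
  D M : ℕ
  D = 3 ^ e
  M = 3 ^ suc e

  private instance
    M≢0 : NonZero M
    M≢0 = m^n≢0 3 (suc e)

  open Layout M using (stride; layout; body; words; length-body)
  open Words w

  module Tree (i : Fin size) = RootedTree (tree i) (isTree i)
  open Tree using (dist; hop)

  terminals : Fin size → List (Fin n)
  terminals i = filter (_∈ₛ? V (tree i)) (allFin n)

  -- The inverse of the hash, used to fill the tables. A slot that no level hashes to gets the value
  -- D.
  level : ℕ → ℕ
  level h = least (λ j → 2 ^ j % M ≟ h) D

  level-hash : ∀ {j} → j < D → level (2 ^ j % M) ≡ j
  level-hash {j} j<D = 2^-mod-injective e M refl l<D j<D (least-holds P? D l<D)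
    where
    P? = λ i → 2 ^ i % M ≟ 2 ^ j % M
    l<D : level (2 ^ j % M) < D
    l<D = ≤-<-trans (least≤ P? D refl) j<D

  module Labels (D≤w : D ≤ w) (deep : 3 ^ D * n < 2 * 4 ^ D) (size≤ : size ≤ 2 ^ w)
    (stride< : stride < 2 ^ w) (n< : n < 2 ^ w) (room : 4 + K * stride < 2 ^ w)
    (F : ℕ) (time : 14 + K * 32 < F) where

    separation : ∀ i → RootedTree.Separation (tree i) (isTree i) D (terminals i)
    separation i = Tree.separate i D (Unique.filter⁺ (_∈ₛ? V (tree i)) (Unique.allFin⁺ n))
      (All.all-filter (_∈ₛ? V (tree i)) (allFin n))
      (≤-<-trans (*-monoʳ-≤ (3 ^ D) (≤-trans (length-filter (_∈ₛ? V (tree i)) (allFin n))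
        (≤-reflexive (length-tabulate (λ v → v))))) deep)

    open RootedTree.Separation

    centre : Fin size → Fin n → ℕ → Fin n
    centre i v h = hub (separation i) v (level h)

    entry : Fin n → Fin size → Entry
    entry v i = record
      { tag  = toℕ i
      ; key  = encode D (code (separation i) v)
      ; tab₁ = λ h → dist i v (centre i v h)
      ; tab₂ = λ h → suc (toℕ (hop i v (centre i v h)))
      ; tab₃ = λ h → suc (toℕ (hop i (centre i v h) v)) }

    labelWords : Fin n → List ℕ
    labelWords v = words n (map (entry v) (trees v))

    length-labelWords : ∀ v → length (labelWords v) ≤ 4 + K * stride
    length-labelWords v = +-monoʳ-≤ 4 (≤-trans
      (≤-reflexive (trans (length-body (map (entry v) (trees v))) (cong (_* stride) (length-map (entry v) (trees v)))))
      (*-monoˡ-≤ stride (sparse v)))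

    fits : ∀ v → Fits (labelWords v)
    fits v = (len< ∷ ≤-<-trans (≤-trans (m≤m+n M (M + M)) (m≤n+m _ 2)) stride< ∷ stride< ∷ n< ∷ entries (trees v)) , len<
      where
      len< : length (labelWords v) < 2 ^ w
      len< = ≤-<-trans (length-labelWords v) room
      entries : ∀ is → All (_< 2 ^ w) (body (map (entry v) is))
      entries []       = []
      entries (i ∷ is) = <-≤-trans (Fin.toℕ<n i) size≤
        ∷ <-≤-trans (encode<2^ D (code (separation i) v)) (^-monoʳ-≤ 2 D≤w)
        ∷ All.++⁺ (All.applyUpTo⁺₂ _ M λ h → ≤-<-trans (Tree.dist≤n i v _) n<)
          (All.++⁺ (All.applyUpTo⁺₂ _ M λ h → ≤-<-trans (Fin.toℕ<n _) n<)
          (All.++⁺ (All.applyUpTo⁺₂ _ M λ h → ≤-<-trans (Fin.toℕ<n _) n<) (entries is)))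

    4≤2^w : 4 ≤ 2 ^ w
    4≤2^w = <⇒≤ (≤-<-trans (m≤m+n 4 _) room)

    scheme : Defs.Scheme G w
    scheme = record
      { label       = λ v → map word (labelWords v)
      ; port        = λ s v → suc (toℕ v)
      ; port-range  = λ {s} {v} _ → s≤s z≤n , Fin.toℕ<n v
      ; port-unique = λ _ _ eq → Fin.toℕ-injective (suc-injective eq) }

    module Decision (s t : Fin n) (s≢t : s ≢ t) where

      open Router w M n (m^n>0 3 (suc e)) (entry s) (entry t) (λ _ → refl) (λ _ → refl)
             (trees s) (trees t) 4≤2^w using (slot; score; answer; module Correct)

      ∈trees⇒∈V : ∀ {v i} → i ∈ trees v → v ∈ₛ V (tree i)
      ∈trees⇒∈V {v} i∈ = proj₂ (∈-filter⁻ (λ i → v ∈ₛ? V (tree i)) {xs = allFin size} i∈)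

      ∈V⇒∈trees : ∀ {v i} → v ∈ₛ V (tree i) → i ∈ trees v
      ∈V⇒∈trees {v} {i} v∈ = ∈-filter⁺ (λ i → v ∈ₛ? V (tree i)) (∈-allFin i) v∈

      record Common (i : Fin size) : Set where
        field
          h       : ℕ
          slot≡   : slot i ≡ h
          centre≡ : centre i s h ≡ centre i t h
          via     : dist i s t ≡ dist i s (centre i s h) + dist i (centre i t h) t

      open Common

      common : ∀ {i} → i ∈ trees s → i ∈ trees t → Common i
      common {i} i∈s i∈t =
        let l , l<D , agree , differ , hubs , eq = separated (separation i)
              (∈-filter⁺ (_∈ₛ? V (tree i)) (∈-allFin s) (∈trees⇒∈V i∈s))
              (∈-filter⁺ (_∈ₛ? V (tree i)) (∈-allFin t) (∈trees⇒∈V i∈t)) s≢t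
        in record
        { h       = 2 ^ l % M
        ; slot≡   = trans (mod≡% w _ M) (cong (_% M)
            (lowest-set-bit (code (separation i) s) (code (separation i) t) D≤w l<D agree differ))
        ; centre≡ = subst (λ j → hub (separation i) s j ≡ hub (separation i) t j) (sym (level-hash l<D)) hubs
        ; via     = subst (λ j → dist i s t ≡ dist i s (hub (separation i) s j) + dist i (hub (separation i) t j) t)
            (sym (level-hash l<D)) eq }

      score≡ : ∀ {i} → Common i → score i ≡ dist i s t
      score≡ {i} C = trans (cong (λ h → dist i s (centre i s h) + dist i t (centre i t h)) (slot≡ C))
        (trans (cong (dist i s (centre i s (h C)) +_) (Tree.dist-sym i t _)) (sym (via C)))

      answer-closer : ∀ {i} → Common i → dist i s t < n → ∃[ v ] (Edge (tree i) s v
        × answer i ≡ suc (toℕ v) × suc (dist i v t) ≤ dist i s t)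
      answer-closer {i} C st<n = decide (0 <? dist i s (centre i s (h C)))
        where
        unfold : answer i ≡ (if 0 <ᵇ dist i s (centre i s (h C)) then suc (toℕ (hop i s (centre i s (h C))))
                             else suc (toℕ (hop i (centre i t (h C)) t)))
        unfold = cong (λ h → if 0 <ᵇ dist i s (centre i s h) then suc (toℕ (hop i s (centre i s h)))
                             else suc (toℕ (hop i (centre i t h) t))) (slot≡ C)
        decide : Dec (0 < dist i s (centre i s (h C))) → ∃[ v ] (Edge (tree i) s v
          × answer i ≡ suc (toℕ v) × suc (dist i v t) ≤ dist i s t)
        decide (yes 0<d) = hop i s x , proj₁ step , trans unfold (branch-< 0<d) ,
          ≤-trans (s≤s (Tree.dist-triangle i (hop i s x) x t))
            (≤-reflexive (trans (cong (_+ dist i x t) (proj₂ step))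
              (trans (cong (λ y → dist i s x + dist i y t) (centre≡ C)) (sym (via C)))))
          where
          x = centre i s (h C)
          step = Tree.hop-closer i
            (≤-<-trans (≤-trans (m≤m+n _ _) (≤-reflexive (sym (via C)))) st<n)
            (λ s≡x → <⇒≢ 0<d (sym (trans (cong (dist i s) (sym s≡x)) (Tree.dist-refl i s))))
        decide (no ¬0<d) = hop i s t , proj₁ step ,
          trans unfold (trans (branch-≮ ¬0<d) (cong (λ y → suc (toℕ (hop i y t))) (sym s≡y))) ,
          ≤-reflexive (proj₂ step)
          where
          s≡y : s ≡ centre i t (h C)
          s≡y = trans (Tree.dist≡0⇒≡ i (n≤0⇒n≡0 (≮⇒≥ ¬0<d))) (centre≡ C)
          step = Tree.hop-closer i st<n s≢t

      -- For distinct vertices a distance below n provides a tree edge at either end. Trees missing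
      -- s or t therefore have the default distance n and cannot beat a common tree.
      dist<n⇒common : ∀ {i} → dist i s t < n → i ∈ trees s × i ∈ trees t
      dist<n⇒common {i} st<n =
        ∈V⇒∈trees (Edge⊆V (tree i) (proj₁ (Tree.hop-closer i st<n s≢t))) ,
        ∈V⇒∈trees (Edge⊆V (tree i) (proj₁ (Tree.hop-closer i (subst (_< n) (Tree.dist-sym i s t) st<n) (s≢t ∘ sym))))

      common-dist<n : ∀ {i} → i ∈ trees s → i ∈ trees t → dist i s t < n
      common-dist<n {i} i∈s i∈t = Tree.dist<n i (∈trees⇒∈V i∈s) (∈trees⇒∈V i∈t)

      open Correct (labelWords s) (labelWords t) refl refl (fits s) (fits t)
        (λ i i∈s i∈t → <-trans (subst (_< n) (sym (score≡ (common i∈s i∈t))) (common-dist<n i∈s i∈t)) n<)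

      closest : ∀ {i} → i ∈ trees s → i ∈ trees t → (∀ j → j ∈ trees s → j ∈ trees t → score i ≤ score j) →
                ∀ j → dist i s t ≤ dist j s t
      closest {i} i∈s i∈t best j with dist j s t <? n
      ... | no ¬st<n = ≤-trans (<⇒≤ (common-dist<n i∈s i∈t)) (≮⇒≥ ¬st<n)
      ... | yes st<n = let j∈s , j∈t = dist<n⇒common st<n in
        subst₂ _≤_ (score≡ (common i∈s i∈t)) (score≡ (common j∈s j∈t)) (best j j∈s j∈t)

      budget< : budget < F
      budget< = ≤-<-trans (≤-trans (+-monoʳ-≤ 10 (+-mono-≤ (+-monoˡ-≤ 1 (*-monoˡ-≤ 4 (sparse s)))
        (+-monoʳ-≤ 2 (+-monoˡ-≤ 1 (*-monoˡ-≤ 28 (sparse t)))))) (≤-reflexive (total K))) time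
        where
        total : ∀ K → 10 + ((K * 4 + 1) + (2 + (K * 28 + 1))) ≡ 14 + K * 32
        total = solve-∀

      decision : ∃[ v ] ∃[ i ] (Routing.ForwardsIn router scheme F s t v × (∀ j → suc (dist i v t) ≤ dist j s t))
      decision =
        let j , s∈ , t∈ , _ = covers s t
            j∈s = ∈V⇒∈trees s∈
            j∈t = ∈V⇒∈trees t∈
            i , i∈s , i∈t , output , best = finds-best j∈s j∈t
              (subst (_< n) (sym (score≡ (common j∈s j∈t))) (common-dist<n j∈s j∈t)) budget<
            v , edge , answer≡ , closer = answer-closer (common i∈s i∈t) (common-dist<n i∈s i∈t)
        in v , i , (Edge⊆G (tree i) edge , trans output (cong just answer≡)) ,
           λ j → ≤-trans closer (closest i∈s i∈t best j)

    open Defs.Scheme scheme using (label)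
    open Routing router scheme renaming (hop to forward)

    -- Different pairs may attain the minimum in different trees, so the triangle inequality can
    -- fail, which a semi-metric allows. The seed n is harmless because no distance exceeds it.
    δ : Fin n → Fin n → ℕ
    δ s t = min n (map (λ i → dist i s t) (allFin size))

    δ≤dist : ∀ i s t → δ s t ≤ dist i s t
    δ≤dist i s t = min≤v⁺ n (map (λ i → dist i s t) (allFin size))
      (inj₂ (Any.map (λ eq → ≤-reflexive (sym eq)) (∈-map⁺ (λ i → dist i s t) (∈-allFin i))))

    ≤δ : ∀ {m s t} → m ≤ n → (∀ i → m ≤ dist i s t) → m ≤ δ s t
    ≤δ m≤n m≤dist = v≤min⁺ m≤n (All.map⁺ (All.universal m≤dist (allFin size)))

    forwards-closer : ∀ {s t v} → s ≢ t → Forwards s t v → suc (δ v t) ≤ δ s t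
    forwards-closer {s} {t} {v} s≢t (f , _ , output) =
      let v′ , i , (_ , output′) , closer = Decision.decision s t s≢t
          v′≡v = Fin.toℕ-injective (suc-injective
            (Execution.run-functional w router (label s) (label t) {F} {f} output′ output))
      in ≤-trans (s≤s (δ≤dist i v t)) (subst (λ u → suc (dist i u t) ≤ δ s t) v′≡v
           (≤δ (≤-trans (closer i) (Tree.dist≤n i s t)) closer))

    δ-refl : ∀ s → δ s s ≡ 0
    δ-refl s = let i , _ = covers s s in n≤0⇒n≡0 (≤-trans (δ≤dist i s s) (≤-reflexive (Tree.dist-refl i s)))

    δ-definite : ∀ s t → δ s t ≡ 0 → s ≡ t
    δ-definite s t δ≡0 with s Fin.≟ t
    ... | yes s≡t = s≡t
    ... | no s≢t  = let v , _ , forwards , _ = Decision.decision s t s≢t in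
      ⊥-elim (n≮0 (subst (δ v t <_) δ≡0 (forwards-closer s≢t (F , forwards))))

    δ-sym : ∀ s t → δ s t ≡ δ t s
    δ-sym s t = ≤-antisym (half s t) (half t s)
      where
      half : ∀ s t → δ s t ≤ δ t s
      half s t = ≤δ (min≤v⁺ n (map (λ i → dist i s t) (allFin size)) (inj₁ ≤-refl))
        λ i → ≤-trans (δ≤dist i s t) (≤-reflexive (Tree.dist-sym i s t))

    route : ∀ m s t → δ s t ≤ m → ∃[ a ] Route t s a
    route m s t δ≤m with s Fin.≟ t
    ... | yes refl = 0 , arrived
    route zero s t δ≤m | no s≢t = ⊥-elim (s≢t (δ-definite s t (n≤0⇒n≡0 δ≤m)))
    route (suc m) s t δ≤m | no s≢t =
      let v , _ , forwards , _ = Decision.decision s t s≢t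
          a , r = route m v t (≤-pred (≤-trans (forwards-closer s≢t (F , forwards)) δ≤m))
      in suc a , forward s≢t (F , forwards) r

    route-length : ∀ {s t a} → Route t s a → a ≤ δ s t
    route-length arrived             = z≤n
    route-length (forward s≢t forwards r) = ≤-trans (s≤s (route-length r)) (forwards-closer s≢t forwards)

    d : Fin n → Fin n → ℝ
    d s t = fromℚ (fromℕ (δ s t))

    d-semiMetric : IsSemiMetric d
    d-semiMetric = ℕ-semiMetric δ δ-refl δ-definite δ-sym

    greedy : GreedyWrt d
    greedy s≢t forwards = fromℚ-mono-< (fromℕ-mono-< (forwards-closer s≢t forwards))

    starvationFree : StarvationFree
    starvationFree s t s≢t = (let v , _ , forwards , _ = Decision.decision s t s≢t in v , F , forwards) ,
                             route (δ s t) s t ≤-refl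

    hasStretch : HasStretch c ℓ
    hasStretch {s} {t} {a} {m} _ r dm =
      let i , _ , _ , b , m′ , db , dm′ , stretch = covers s t
          p , len≡b = Distance.attained db
      in WithinStretch-≤ c ℓ {m = m} (≤-trans (route-length r) (≤-trans (δ≤dist i s t)
           (≤-trans (Tree.dist≤ i {len p} (Tree.walk i (Path.walk p))) (≤-reflexive len≡b))))
           (subst (WithinStretch c ℓ b) (distance-unique dm′ dm) stretch)

    decisionTime : DecisionTime≤ F
    decisionTime s t s≢t = let v , _ , forwards , _ = Decision.decision s t s≢t in v , forwards

    storedBits≤ : ∀ v → Scheme.storedBits scheme v ≤ w * (4 + K * stride)
    storedBits≤ v = *-monoʳ-≤ w (≤-trans (≤-reflexive (length-map word (labelWords v))) (length-labelWords v))

-- Two ways of indexing a tree cover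

module _ {n : ℕ} {G : Graph n} {c ℓ : ℝ} {k : ℕ} {𝒞 : List (Subgraph G)} (cover : IsTreeCover G c ℓ k 𝒞) where
  open IsTreeCover cover
  open Subgraph

  all-trees : IndexedCover G c ℓ k
  all-trees = record
    { size   = length 𝒞
    ; tree   = lookup 𝒞
    ; isTree = λ i → All.lookup trees (∈-lookup i)
    ; covers = λ s t → Any.index (covers s t) , Any.lookup-index (covers s t)
    ; sparse = λ v → ≤-trans (≤-reflexive (trans (count-map (λ H → v ∈ₛ? V H) (lookup 𝒞) (allFin (length 𝒞)))
        (cong (count (λ H → v ∈ₛ? V H)) (trans (map-tabulate (λ i → i) (lookup 𝒞)) (tabulate-lookup 𝒞)))))
        (sparse v) }

  -- Every tree has a vertex and every vertex is in at most k trees. The bound is what makes the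
  -- tags fit into words.
  length≤n*k : length 𝒞 ≤ n * k
  length≤n*k = ≤-trans (double-counting (λ v H → v ∈ₛ? V H) k (allFin n) 𝒞 sparse
      (All.map (λ tree → let v , v∈V = IsTree.nonempty tree in lose (∈-allFin v) v∈V) trees))
    (≤-reflexive (cong (_* k) (length-tabulate (λ (v : Fin n) → v))))

  -- The index is the pair itself. A tree chosen for several pairs appears under several tags, and
  -- the number of all indices bounds those at a vertex.
  one-tree-per-pair : IndexedCover G c ℓ (n * n)
  one-tree-per-pair = record
    { size   = n * n
    ; tree   = λ i → lookup 𝒞 (chosen i)
    ; isTree = λ i → All.lookup trees (∈-lookup (chosen i))
    ; covers = λ s t → combine s t , subst (λ (s′ , t′) → let H = lookup 𝒞 (Any.index (covers s′ t′)) in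
        s ∈ₛ V H × t ∈ₛ V H × ∃[ a ] ∃[ m ] Distance (Edge H) s t a × Distance (Graph._~_ G) s t m × WithinStretch c ℓ a m)
        (sym (Fin.remQuot-combine s t)) (Any.lookup-index (covers s t))
    ; sparse = λ v → ≤-trans (length-filter (λ i → v ∈ₛ? V (lookup 𝒞 (chosen i))) (allFin (n * n)))
        (≤-reflexive (length-tabulate (λ (i : Fin (n * n)) → i))) }
    where
    chosen : Fin (n * n) → Fin (length 𝒞)
    chosen i = Any.index (let s , t = remQuot {n} n i in covers s t)

-- Numerical estimates

n<2^n : ∀ n → n < 2 ^ n
n<2^n zero    = s≤s z≤n
n<2^n (suc n) = ≤-trans (+-mono-≤ (m^n>0 2 n) (n<2^n n)) (≤-reflexive (cong (2 ^ n +_) (sym (+-identityʳ _))))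

n<2^[1+log₂n] : ∀ n → n < 2 ^ (1 + ⌊log₂ n ⌋)
n<2^[1+log₂n] n = ≰⇒> λ 2^≤n → 1+n≰n (≤-trans (≤-reflexive (sym (⌊log₂[2^n]⌋≡n _))) (⌊log₂⌋-mono-≤ 2^≤n))

log₂≤ : ∀ {a} b → a ≤ 2 ^ b → ⌊log₂ a ⌋ ≤ b
log₂≤ b a≤ = ≤-trans (⌊log₂⌋-mono-≤ a≤) (≤-reflexive (⌊log₂[2^n]⌋≡n b))

power-of-3 : ∀ l → ∃[ e ] (suc l ≤ 3 ^ e × 3 ^ e ≤ 3 * suc l)
power-of-3 zero = 0 , s≤s z≤n , s≤s z≤n
power-of-3 (suc l) with power-of-3 l
... | e , lo , hi with m≤n⇒m<n∨m≡n lo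
...   | inj₁ l<  = e , l< , ≤-trans hi (*-monoʳ-≤ 3 (n≤1+n (suc l)))
...   | inj₂ l≡  = suc e ,
          ≤-trans (+-mono-≤ (s≤s z≤n) (m≤m+n (suc l) _)) (≤-reflexive (cong (3 *_) l≡)) ,
          *-monoʳ-≤ 3 (≤-trans (≤-reflexive (sym l≡)) (n≤1+n (suc l)))

^-distribʳ-* : ∀ a b o → (a * b) ^ o ≡ a ^ o * b ^ o
^-distribʳ-* a b zero    = refl
^-distribʳ-* a b (suc o) = trans (cong (a * b *_) (^-distribʳ-* a b o)) (interchange a b (a ^ o) (b ^ o))
  where
  interchange : ∀ a b c d → a * b * (c * d) ≡ a * c * (b * d)
  interchange = solve-∀

-- Three levels at least halve the size of a part, since 27 · 2 = 54 ≤ 64. So 3Λ levels reduce 2^Λ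
-- vertices to at most one, and r further levels do no harm.
3^D*n<2*4^D : ∀ Λ r {n} → n ≤ 2 ^ Λ → 3 ^ (3 * Λ + r) * n < 2 * 4 ^ (3 * Λ + r)
3^D*n<2*4^D Λ r {n} n≤ = ≤-<-trans (begin
  3 ^ (3 * Λ + r) * n            ≡⟨ cong (_* n) (^-distribˡ-+-* 3 (3 * Λ) r) ⟩
  3 ^ (3 * Λ) * 3 ^ r * n        ≤⟨ *-monoʳ-≤ (3 ^ (3 * Λ) * 3 ^ r) n≤ ⟩
  3 ^ (3 * Λ) * 3 ^ r * 2 ^ Λ    ≡⟨ swap (3 ^ (3 * Λ)) (3 ^ r) (2 ^ Λ) ⟩
  3 ^ (3 * Λ) * 2 ^ Λ * 3 ^ r    ≡⟨ cong (λ x → x * 2 ^ Λ * 3 ^ r) (^-*-assoc 3 3 Λ) ⟨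
  27 ^ Λ * 2 ^ Λ * 3 ^ r         ≡⟨ cong (_* 3 ^ r) (^-distribʳ-* 27 2 Λ) ⟨
  54 ^ Λ * 3 ^ r                 ≤⟨ *-mono-≤ (^-monoˡ-≤ Λ (m≤m+n 54 10)) (^-monoˡ-≤ r (n≤1+n 3)) ⟩
  64 ^ Λ * 4 ^ r                 ≡⟨ cong (_* 4 ^ r) (^-*-assoc 4 3 Λ) ⟩
  4 ^ (3 * Λ) * 4 ^ r            ≡⟨ ^-distribˡ-+-* 4 (3 * Λ) r ⟨
  4 ^ (3 * Λ + r)                ∎)
  (≤-trans (+-monoˡ-≤ _ (m^n>0 4 (3 * Λ + r))) (≤-reflexive (cong (4 ^ (3 * Λ + r) +_) (sym (+-identityʳ _)))))
  where
  open ≤-Reasoning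
  swap : ∀ a b c → a * b * c ≡ a * c * b
  swap = solve-∀

-- As 83 < 2^7, already X^9 exceeds the left-hand side; 20 is the constant of the word size, chosen
-- with room to spare.
83*X²<X^20 : ∀ {X} → 2 ≤ X → 83 * (X * X) < X ^ 20
83*X²<X^20 {X@(suc _)} 2≤X = begin-strict
  83 * (X * X)           <⟨ *-monoˡ-< (X * X) (m≤m+n 84 44) ⟩
  128 * (X * X)          ≤⟨ *-monoˡ-≤ (X * X) (^-monoˡ-≤ 7 2≤X) ⟩
  X ^ 7 * (X * X)        ≡⟨ cong (X ^ 7 *_) (cong (X *_) (*-identityʳ X)) ⟨
  X ^ 7 * X ^ 2          ≡⟨ ^-distribˡ-+-* X 7 2 ⟨
  X ^ 9                  ≤⟨ ^-monoʳ-≤ X (m≤m+n 9 11) ⟩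
  X ^ 20                 ∎
  where open ≤-Reasoning

fits-word : ∀ s {X a} → X ≡ 2 ^ s → 2 ≤ X → a ≤ 83 * (X * X) → a < 2 ^ (20 * s)
fits-word s {X} refl 2≤X a≤ = ≤-<-trans a≤ (subst (83 * (X * X) <_)
  (trans (^-*-assoc 2 s 20) (cong (2 ^_) (*-comm s 20))) (83*X²<X^20 2≤X))

stride-bound : ∀ {d Λ} → d ≤ 9 * Λ → 2 + (3 * d + (3 * d + 3 * d)) ≤ 2 + 81 * Λ
stride-bound {d} {Λ} d≤ = +-monoʳ-≤ 2 (begin
  3 * d + (3 * d + 3 * d)   ≡⟨ triple d ⟩
  9 * d                     ≤⟨ *-monoʳ-≤ 9 d≤ ⟩
  9 * (9 * Λ)               ≡⟨ *-assoc 9 9 Λ ⟨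
  81 * Λ                    ∎)
  where
  open ≤-Reasoning
  triple : ∀ d → 3 * d + (3 * d + 3 * d) ≡ 9 * d
  triple = solve-∀

stride≤82*X : ∀ {X Λ σ} → 2 ≤ X → Λ ≤ X → σ ≤ 2 + 81 * Λ → σ ≤ 82 * X
stride≤82*X 2≤X Λ≤X σ≤ = ≤-trans σ≤ (+-mono-≤ 2≤X (*-monoʳ-≤ 81 Λ≤X))

room-bound : ∀ {X K σ} → 2 ≤ X → K ≤ X → σ ≤ 82 * X → 4 + K * σ ≤ 83 * (X * X)
room-bound {X} {K} {σ} 2≤X K≤X σ≤ = begin
  4 + K * σ                 ≤⟨ +-mono-≤ (*-mono-≤ 2≤X 2≤X) (*-mono-≤ K≤X σ≤) ⟩
  X * X + X * (82 * X)      ≡⟨ cong (X * X +_) (x∙yz≈y∙xz X 82 X) ⟩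
  83 * (X * X)              ∎
  where
  open ≤-Reasoning
  x∙yz≈y∙xz : ∀ x y z → x * (y * z) ≡ y * (x * z)
  x∙yz≈y∙xz = solve-∀

-- Per tree, 4 steps record an entry of s and 28 handle an entry of t. The 14 are the prologue, the
-- two loop exits and the rewinding in between; strictness leaves a step for `halt`.
time-bound : ∀ {K k} → 1 ≤ K → K ≤ k → 14 + K * 32 < 47 * k
time-bound {K} {k} 1≤K K≤k = begin
  15 * 1 + K * 32           ≤⟨ +-mono-≤ (*-monoʳ-≤ 15 (≤-trans 1≤K K≤k)) (*-monoˡ-≤ 32 K≤k) ⟩
  15 * k + k * 32           ≡⟨ cong (15 * k +_) (*-comm k 32) ⟩
  15 * k + 32 * k           ≡⟨ *-distribʳ-+ k 15 32 ⟨
  47 * k                    ∎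
  where open ≤-Reasoning

-- 26880 = 20 · (4 + 164) · 8. For l ≥ 1 a word has at most 20(2l + k′) bits and an entry at most
-- 164 l words. The hypothesis on `8 * T` isolates the comparison that depends on how many trees are
-- stored.
storage-bound : ∀ {l k′ K σ T} → 1 ≤ l → 1 ≤ K → σ ≤ 2 + 81 * (1 + l) →
  (2 * l + k′) * (K * l) ≤ 8 * T → 20 * (1 + l + k′) * (4 + K * σ) ≤ 26880 * T
storage-bound {l} {k′} {K} {σ} {T} 1≤l 1≤K σ≤ main = begin
  20 * (1 + l + k′) * (4 + K * σ)
    ≤⟨ *-mono-≤ (*-monoʳ-≤ 20 (+-monoˡ-≤ k′ 1+l≤2l)) (+-mono-≤ (*-monoʳ-≤ 4 (*-mono-≤ 1≤K 1≤l)) (*-monoʳ-≤ K σ≤164l)) ⟩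
  20 * (2 * l + k′) * (4 * (K * l) + K * (164 * l))
    ≡⟨ collect 20 4 164 (2 * l + k′) K l ⟩
  20 * (4 + 164) * ((2 * l + k′) * (K * l))
    ≤⟨ *-monoʳ-≤ 3360 main ⟩
  3360 * (8 * T)
    ≡⟨ *-assoc 3360 8 T ⟨
  26880 * T ∎
  where
  open ≤-Reasoning
  1+l≤2l : 1 + l ≤ 2 * l
  1+l≤2l = ≤-trans (+-monoˡ-≤ l 1≤l) (≤-reflexive (cong (l +_) (sym (+-identityʳ l))))
  σ≤164l : σ ≤ 164 * l
  σ≤164l = begin
    σ                    ≤⟨ σ≤ ⟩
    2 + 81 * (1 + l)     ≤⟨ +-mono-≤ (*-monoʳ-≤ 2 1≤l) (*-monoʳ-≤ 81 1+l≤2l) ⟩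
    2 * l + 81 * (2 * l) ≡⟨ cong (2 * l +_) (*-assoc 81 2 l) ⟨
    2 * l + 162 * l      ≡⟨ *-distribʳ-+ l 2 162 ⟨
    164 * l              ∎
  collect : ∀ a b c x K l → a * x * (b * (K * l) + K * (c * l)) ≡ a * (b + c) * (x * (K * l))
  collect = solve-∀

module Magnitudes (n k : ℕ) where

  l k′ Λ s X : ℕ
  l  = ⌊log₂ n ⌋
  k′ = ⌊log₂ k ⌋
  Λ  = 1 + l
  s  = 1 + l + k′
  X  = 2 ^ s

  2≤X : 2 ≤ X
  2≤X = ^-monoʳ-≤ 2 (s≤s (z≤n {l + k′}))

  Λ≤X : Λ ≤ X
  Λ≤X = ≤-trans (m≤m+n Λ k′) (<⇒≤ (n<2^n s))

  n≤X : n ≤ X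
  n≤X = ≤-trans (<⇒≤ (n<2^[1+log₂n] n)) (^-monoʳ-≤ 2 (m≤m+n Λ k′))

  k≤X : k ≤ X
  k≤X = ≤-trans (<⇒≤ (n<2^[1+log₂n] k)) (^-monoʳ-≤ 2 (s≤s (m≤n+m k′ l)))

  1≤l : 2 ≤ n → 1 ≤ l
  1≤l = ⌊log₂⌋-mono-≤

-- Choice of parameters

Implementation : (n k : ℕ) (G : Graph n) (c ℓ : ℝ) → Set₁
Implementation n k G c ℓ = Σ[ S ∈ Scheme G (wordSize 20 n k) ]
  (let open Routing router S in
   (Σ[ d ∈ (Fin n → Fin n → ℝ) ] (IsSemiMetric d × GreedyWrt d))
   × StarvationFree
   × HasStretch c ℓ
   × (∀ v → Scheme.storedBits S v ≤ 26880 * (k * (⌊log₂ n ⌋ ^ 2 + ⌊log₂ k ⌋)))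
   × DecisionTime≤ (47 * k))

module Sized {n k K : ℕ} {G : Graph n} {c ℓ : ℝ} (cover : IndexedCover G c ℓ K)
  (2≤n : 2 ≤ n) (1≤K : 1 ≤ K) (K≤k : K ≤ k)
  (size≤ : IndexedCover.size cover ≤ Magnitudes.X n k * Magnitudes.X n k)
  (storage≤ : (2 * ⌊log₂ n ⌋ + ⌊log₂ k ⌋) * (K * ⌊log₂ n ⌋) ≤ 8 * (k * (⌊log₂ n ⌋ ^ 2 + ⌊log₂ k ⌋))) where
  open Magnitudes n k

  w : ℕ
  w = wordSize 20 n k

  -- The power of 3 found for l lies between Λ and 3Λ; one more factor 3 supplies the three levels
  -- that each halving takes.
  e : ℕ
  e = suc (proj₁ (power-of-3 l))

  3Λ≤D : 3 * Λ ≤ 3 ^ e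
  3Λ≤D = *-monoʳ-≤ 3 (proj₁ (proj₂ (power-of-3 l)))

  D≤9Λ : 3 ^ e ≤ 9 * Λ
  D≤9Λ = ≤-trans (*-monoʳ-≤ 3 (proj₂ (proj₂ (power-of-3 l)))) (≤-reflexive (sym (*-assoc 3 3 Λ)))

  deep : 3 ^ (3 ^ e) * n < 2 * 4 ^ (3 ^ e)
  deep = subst (λ D → 3 ^ D * n < 2 * 4 ^ D) (m+[n∸m]≡n 3Λ≤D)
    (3^D*n<2*4^D Λ (3 ^ e ∸ 3 * Λ) (<⇒≤ (n<2^[1+log₂n] n)))

  D≤w : 3 ^ e ≤ w
  D≤w = ≤-trans D≤9Λ (*-mono-≤ (m≤m+n 9 11) (m≤m+n Λ k′))

  open Layout (3 ^ suc e) using (stride)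

  stride≤ : stride ≤ 2 + 81 * Λ
  stride≤ = stride-bound {3 ^ e} {Λ} D≤9Λ

  stride≤X : stride ≤ 82 * X
  stride≤X = stride≤82*X {X} {Λ} {stride} 2≤X Λ≤X stride≤

  below : ∀ {a} → a ≤ 83 * (X * X) → a < 2 ^ w
  below = fits-word s {X} refl 2≤X

  ≤X⇒≤83*X² : ∀ {a} → a ≤ 82 * X → a ≤ 83 * (X * X)
  ≤X⇒≤83*X² a≤ = ≤-trans a≤ (*-mono-≤ (n≤1+n 82) (m≤m*n X X {{m^n≢0 2 s}}))

  open Construction cover w e
  open Labels D≤w deep
    (≤-trans size≤ (<⇒≤ (below (m≤n*m (X * X) 83))))
    (below (≤X⇒≤83*X² stride≤X))
    (below (≤X⇒≤83*X² (≤-trans n≤X (m≤n*m X 82))))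
    (below (room-bound {X} {K} {stride} 2≤X (≤-trans K≤k k≤X) stride≤X))
    (47 * k) (time-bound 1≤K K≤k)

  implementation : Implementation n k G c ℓ
  implementation = scheme , (d , d-semiMetric , greedy) , starvationFree , hasStretch ,
    (λ v → ≤-trans (storedBits≤ v)
      (storage-bound {l} {k′} {K} {stride} {k * (l ^ 2 + k′)} (1≤l 2≤n) 1≤K stride≤ storage≤)) , decisionTime

module Trivial {n k : ℕ} {G : Graph n} {c ℓ : ℝ} (one : ∀ (s t : Fin n) → s ≡ t) where

  -- With at most one vertex `⌊log₂ n ⌋` is 0 and the storage bound can vanish, so that even the
  -- header would be too long; empty labels suffice, as no message has to travel.
  implementation : Implementation n k G c ℓ
  implementation = record
      { label       = λ _ → []
      ; port        = λ s v → suc (toℕ v)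
      ; port-range  = λ {s} {v} _ → s≤s z≤n , Fin.toℕ<n v
      ; port-unique = λ _ _ _ → one _ _ } ,
    (_ , ℕ-semiMetric (λ _ _ → 0) (λ _ → refl) (λ s t _ → one s t) (λ _ _ → refl) ,
     (λ s≢t _ → ⊥-elim (s≢t (one _ _)))) ,
    (λ s t s≢t → ⊥-elim (s≢t (one s t))) ,
    (λ s≢t → ⊥-elim (s≢t (one _ _))) ,
    (λ v → ≤-trans (≤-reflexive (*-zeroʳ (wordSize 20 n k))) z≤n) ,
    (λ s t s≢t → ⊥-elim (s≢t (one s t)))

module Nontrivial {n k : ℕ} {G : Graph n} {c ℓ : ℝ} {𝒞 : List (Subgraph G)}
  (cover : IsTreeCover G c ℓ k 𝒞) (2≤n : 2 ≤ n) where
  open Magnitudes n k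

  private instance
    n≢0 : NonZero n
    n≢0 = >-nonZero (<⇒≤ 2≤n)

  Λ≤2l : Λ ≤ 2 * l
  Λ≤2l = ≤-trans (+-monoˡ-≤ l (1≤l 2≤n)) (≤-reflexive (cong (l +_) (sym (+-identityʳ l))))

  1≤k : 1 ≤ k
  1≤k = let v = Fin.fromℕ< {0} (<⇒≤ 2≤n) in ≤-trans
    (filter-some (λ H → v ∈ₛ? Subgraph.V H) (Any.map proj₁ (IsTreeCover.covers cover v v)))
    (IsTreeCover.sparse cover v)

  l²≤ : l * l ≤ l ^ 2 + k′
  l²≤ = ≤-trans (≤-reflexive (cong (l *_) (sym (*-identityʳ l)))) (m≤m+n (l ^ 2) k′)

  -- If k ≤ n³, then k′ ≤ 3Λ ≤ 6l, and the mixed term l · k′ is absorbed by l². Otherwise K = n²,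
  -- and n² · l ≤ n³ ≤ k turns the mixed term K · l · k′ into k · k′.
  by-size : Dec (k ≤ n * (n * n)) → Implementation n k G c ℓ
  by-size (yes k≤n³) = Sized.implementation (all-trees cover) 2≤n 1≤k ≤-refl
    (≤-trans (length≤n*k cover) (*-mono-≤ n≤X k≤X)) (begin
      (2 * l + k′) * (k * l)          ≤⟨ *-monoˡ-≤ (k * l) (+-monoʳ-≤ (2 * l) k′≤) ⟩
      (2 * l + 2 * l * 3) * (k * l)   ≡⟨ collect l k ⟩
      8 * (k * (l * l))               ≤⟨ *-monoʳ-≤ 8 (*-monoʳ-≤ k l²≤) ⟩
      8 * (k * (l ^ 2 + k′))          ∎)
    where
    open ≤-Reasoning
    collect : ∀ l k → (2 * l + 2 * l * 3) * (k * l) ≡ 8 * (k * (l * l))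
    collect = solve-∀
    k′≤ : k′ ≤ 2 * l * 3
    k′≤ = ≤-trans (log₂≤ (Λ * 3) (begin
      k               ≤⟨ k≤n³ ⟩
      n * (n * n)     ≡⟨ cong (λ m → n * (n * m)) (*-identityʳ n) ⟨
      n ^ 3           ≤⟨ ^-monoˡ-≤ 3 (<⇒≤ (n<2^[1+log₂n] n)) ⟩
      (2 ^ Λ) ^ 3     ≡⟨ ^-*-assoc 2 Λ 3 ⟩
      2 ^ (Λ * 3)     ∎)) (*-monoˡ-≤ 3 Λ≤2l)
  by-size (no k≰n³) = Sized.implementation (one-tree-per-pair cover) 2≤n (*-mono-≤ (<⇒≤ 2≤n) (<⇒≤ 2≤n))
    n²≤k
    (*-mono-≤ n≤X n≤X) (begin
      (2 * l + k′) * (n * n * l)                  ≡⟨ *-distribʳ-+ (n * n * l) (2 * l) k′ ⟩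
      2 * l * (n * n * l) + k′ * (n * n * l)      ≤⟨ +-mono-≤ (*-monoʳ-≤ (2 * l) (*-monoˡ-≤ l n²≤k)) (*-monoʳ-≤ k′ n²l≤k) ⟩
      2 * l * (k * l) + k′ * k                    ≤⟨ m≤m+n _ (6 * (k * (l * l)) + 7 * (k * k′)) ⟩
      2 * l * (k * l) + k′ * k + (6 * (k * (l * l)) + 7 * (k * k′)) ≡⟨ collect l k k′ ⟩
      8 * (k * (l * l + k′))                      ≡⟨ cong (λ m → 8 * (k * (l * m + k′))) (*-identityʳ l) ⟨
      8 * (k * (l ^ 2 + k′))                      ∎)
    where
    open ≤-Reasoning
    collect : ∀ l k k′ → 2 * l * (k * l) + k′ * k + (6 * (k * (l * l)) + 7 * (k * k′)) ≡ 8 * (k * (l * l + k′))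
    collect = solve-∀
    n³≤k : n * (n * n) ≤ k
    n³≤k = <⇒≤ (≰⇒> k≰n³)
    n²≤k : n * n ≤ k
    n²≤k = ≤-trans (m≤n*m (n * n) n) n³≤k
    n²l≤k : n * n * l ≤ k
    n²l≤k = ≤-trans (*-monoʳ-≤ (n * n) (log₂≤ n (<⇒≤ (n<2^n n))))
      (≤-trans (≤-reflexive (*-assoc n n n)) n³≤k)

at-most-one : ∀ {n} → ¬ 2 ≤ n → ∀ (s t : Fin n) → s ≡ t
at-most-one {n} n≤1 s t = Fin.toℕ-injective (trans (is-zero s) (sym (is-zero t)))
  where
  is-zero : ∀ (s : Fin n) → toℕ s ≡ 0
  is-zero s = n<1⇒n≡0 (<-≤-trans (Fin.toℕ<n s) (≤-pred (≰⇒> n≤1)))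

implement : ∀ n k (G : Graph n) (c ℓ : ℝ) (𝒞 : List (Subgraph G)) → IsTreeCover G c ℓ k 𝒞 →
            Dec (2 ≤ n) → Implementation n k G c ℓ
implement n k G c ℓ 𝒞 cover (yes 2≤n) = Nontrivial.by-size {n} {k} {G} {c} {ℓ} {𝒞} cover 2≤n (k ≤? n * (n * n))
implement n k G c ℓ 𝒞 cover (no n≤1)  = Trivial.implementation {n} {k} {G} {c} {ℓ} (at-most-one n≤1)

theorem12 : Σ[ P ∈ Program ] ∃[ A ] ∃[ B ] ∃[ C ]
    (∀ (n k : ℕ) (G : Graph n) (c ℓ : ℝ) (𝒞 : List (Subgraph G)) →
    IsTreeCover G c ℓ k 𝒞 →
    Σ[ S ∈ Scheme G (wordSize A n k) ]
    (let open Routing P S in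
    (Σ[ d ∈ (Fin n → Fin n → ℝ) ] (IsSemiMetric d × GreedyWrt d))
    × StarvationFree
    × HasStretch c ℓ
    × (∀ v → Scheme.storedBits S v ≤ B * (k * (⌊log₂ n ⌋ ^ 2 + ⌊log₂ k ⌋)))
    × DecisionTime≤ (C * k)))
theorem12 = router , 20 , 26880 , 47 , λ n k G c ℓ 𝒞 cover → implement n k G c ℓ 𝒞 cover (2 ≤? n)
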